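{- Let $p$ be a prime, $N=p^e$ with $e\ge1$, let $h\ge1$ be a divisor of $N-1$, put $A=(N-1)/h$ and $\Lambda_{N,h}(U)=U(U^A-1)^h\in\mathbb F_p[U]$. Let $Q=p^m$ with $m\ge1$ and put $$s=p^{\gcd(e,m)},\qquad C=\frac{N-1}{s-1},\qquad \kappa=\gcd(h,C).$$ For $t\in\mathbb F_Q$ let $r_Q(t)=\#\{u\in\mathbb F_Q:\Lambda_{N,h}(u)=t\}$. Then $$r_Q(0)=1+\frac{\kappa(s-1)}{h}.$$ Among nonzero target values $t\in\mathbb F_Q^\times$, the only possible values of $r_Q(t)$ are $0$, $1$ and $s$, and $$\#\{t\in\mathbb F_Q^\times:r_Q(t)=0\}=\frac{\kappa(s-1)Q}{hs},$$ $$\#\{t\in\mathbb F_Q^\times:r_Q(t)=1\}=\frac{(h-\kappa)(Q-1)}{h},$$ $$\#\{t\in\mathbb F_Q^\times:r_Q(t)=s\}=\frac{\kappa(Q-s)}{hs}.$$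
   Context: Fibres are counted as sets of $\mathbb F_Q$-rational points, without multiplicity. Since $\gcd(e,m)\mid e$, the number $s-1$ divides $N-1$, so $C$ is an integer. -}

module Defs where

open import Algebra.Apartness.Bundles using (HeytingField; HeytingCommutativeRing)
open import Algebra.Bundles using (CommutativeRing)
open import Data.Fin.Base using (Fin)
import Data.Fin.Properties as Fin
open import Data.Nat.Base hiding (_⊔_; _/_)
open import Data.Nat.Divisibility
open import Data.Nat.DivMod using (_/_)
open import Data.Nat.GCD using (gcd; gcd[m,n]∣m; gcd[m,n]≡0⇒m≡0)
open import Data.Nat.Primality using (Prime; prime⇒nonTrivial)
open import Data.Nat.Properties
open import Data.Vec.Base using (count; tabulate)
open import Function.Bundles using (Inverse)
open import Level using (_⊔_) renaming (suc to lsuc)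
open import Relation.Binary.Definitions using () renaming (Decidable to Decidable₂)
open import Relation.Binary.PropositionalEquality renaming (setoid to ≡-setoid)
open import Relation.Nullary.Decidable using (map′)
open import Relation.Unary using (Pred; Decidable)

-- A field with exactly q elements, up to its setoid equality.  Since the
-- carrier is finite, _≈_ and invertibility are decidable, so tightness of the
-- apartness makes every x with x ≉ 0# invertible: this is an ordinary finite
-- field, and every finite field is an instance with _#_ taken to be _≉_.
record FiniteField c ℓ₁ ℓ₂ (q : ℕ) : Set (lsuc (c ⊔ ℓ₁ ⊔ ℓ₂)) where
  field
    heytingField : HeytingField c ℓ₁ ℓ₂

  commutativeRing : CommutativeRing c ℓ₁
  commutativeRing =
    HeytingCommutativeRing.commutativeRing (HeytingField.heytingCommutativeRing heytingField)

  open CommutativeRing commutativeRing public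
    using (Carrier; _≈_; _≉_; 0#; 1#; setoid; semiring)
    renaming (_*_ to _*ᶠ_; _-_ to _-ᶠ_)

  field
    enumeration : Inverse (≡-setoid (Fin q)) setoid

  open import Algebra.Properties.Semiring.Exp semiring public
    using () renaming (_^_ to _^ᶠ_)

  open Inverse enumeration public using ()
    renaming (to to element; from to index; from-cong to index-cong;
              to-cong to element-cong; strictlyInverseˡ to element-index)

  infix 4 _≟ᶠ_

  _≟ᶠ_ : Decidable₂ _≈_
  x ≟ᶠ y = map′ index-injective index-cong (index x Fin.≟ index y)
    where
    open CommutativeRing commutativeRing using () renaming (trans to ≈-trans; sym to ≈-sym)
    index-injective : index x ≡ index y → x ≈ y
    index-injective eq =
      ≈-trans (≈-sym (element-index x)) (≈-trans (element-cong eq) (element-index y))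

  -- The number of field elements satisfying P.
  #[_] : ∀ {a} {P : Pred Carrier a} → Decidable P → ℕ
  #[ P? ] = count P? (tabulate element)

  -- The value at u of U(U^A - 1)^h with A = (N - 1) / h.
  Λ : (N h : ℕ) → .{{_ : NonZero h}} → Carrier → Carrier
  Λ N h u = u *ᶠ ((u ^ᶠ ((N ∸ 1) / h)) -ᶠ 1#) ^ᶠ h

  r : (N h : ℕ) → .{{_ : NonZero h}} → Carrier → ℕ
  r N h t = #[ (λ u → Λ N h u ≟ᶠ t) ]

p^gcd∸1-nonZero : ∀ {p} → Prime p → ∀ e m → .{{NonZero e}} → NonZero (p ^ gcd e m ∸ 1)
p^gcd∸1-nonZero {p} p-prime e m = >-nonZero (m<n⇒0<n∸m 1<s)
  where
  instance
    _ = prime⇒nonTrivial p-prime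
    _ = ≢-nonZero {gcd e m} (λ eq → ≢-nonZero⁻¹ e (gcd[m,n]≡0⇒m≡0 eq))
  1<s : 1 < p ^ gcd e m
  1<s = <-≤-trans (nonTrivial⇒n>1 p)
          (subst (_≤ p ^ gcd e m) (^-identityʳ p)
            (^-monoʳ-≤ p {{nonTrivial⇒nonZero p}} (>-nonZero⁻¹ (gcd e m))))

m∸1∣m^n∸1 : ∀ m n → .{{NonZero m}} → m ∸ 1 ∣ m ^ n ∸ 1
m∸1∣m^n∸1 m       zero    = (m ∸ 1) ∣0
m∸1∣m^n∸1 (suc k) (suc n) = subst (k ∣_) eq
  (∣m∣n⇒∣m+n (m∸1∣m^n∸1 (suc k) n) (m∣m*n (suc k ^ n)))
  where
  eq : (suc k ^ n ∸ 1) + k * suc k ^ n ≡ suc k ^ suc n ∸ 1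
  eq = sym (+-∸-comm (k * suc k ^ n) (m^n>0 (suc k) n))

-- Hence the ℕ-division (p ^ e ∸ 1) / (p ^ gcd e m ∸ 1) is exact.
p^gcd∸1∣p^e∸1 : ∀ {p} → Prime p → ∀ e m → p ^ gcd e m ∸ 1 ∣ p ^ e ∸ 1
p^gcd∸1∣p^e∸1 {p} p-prime e m with gcd[m,n]∣m e m
... | divides k e≡k*g = subst (λ x → p ^ g ∸ 1 ∣ x ∸ 1) eq (m∸1∣m^n∸1 (p ^ g) k {{m^n≢0 p g}})
  where
  g = gcd e m
  instance
    _ = nonTrivial⇒nonZero p {{prime⇒nonTrivial p-prime}}
  eq : (p ^ g) ^ k ≡ p ^ e
  eq = trans (^-*-assoc p g k) (cong (p ^_) (trans (*-comm g k) (sym e≡k*g)))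

{-# OPTIONS --safe #-}
module Submission where

-- For Λ(u) ≠ 0 and a = u^A, the fibre of Λ through u consists of the elements u (1 + z)^h,
-- where z runs over the kernel of the additive map z ↦ a z^N - z. A nonzero z in this kernel
-- is a solution of a z^(N-1) = 1; since the (N-1)-th roots of unity in F are the
-- (s-1)-th ones, there are either none or s - 1 of these, and the fibre has 1 or s points.
-- Counting the pairs (u, z) with u^A z^(N-1) = (u z^h)^A = 1 in two ways determines how
-- many u have solutions, and double counting along Λ turns this into numbers of fibres.

open import Algebra.Apartness.Bundles using (HeytingField)
open import Algebra.Bundles using (CommutativeMonoid; CommutativeRing; CommutativeSemiring)
import Algebra.Properties.CommutativeMonoid.Sum as CommutativeMonoidSum
open import Data.Bool.Base using (if_then_else_; true; false)
open import Data.Fin.Base using (Fin; zero; suc; toℕ; inject₁; fromℕ)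
open import Data.Fin.Permutation using (Permutation′; permutation)
import Data.Fin.Properties as Fin
open import Data.Integer.Base as ℤ using (+_)
import Data.Integer.Properties as ℤ
open import Data.Nat
  using (ℕ; zero; suc; pred; NonZero; _+_; _*_; _∸_; _^_; _!; _≤_; _<_; z≤n; s≤s; _≟_; ≢-nonZero
    ; ≢-nonZero⁻¹; nonTrivial⇒≢1)
import Data.Nat.Combinatorics as ℕ
open import Data.Nat.Combinatorics using (nCk≡n!/k![n-k]!; k![n∸k]!∣n!; nCn≡1)
open import Data.Nat.Divisibility using (_∣_; _∤_; divides; ∣1⇒≡1; >⇒∤; m∣m*n; n∣m*n; ∣-trans)
open import Data.Nat.DivMod using (_/_; m/n*n≡m; m*[n/m]≡n)
open import Data.Nat.GCD
  using (gcd; gcd-GCD; gcd-comm; gcd-identityʳ; gcd[m,n]∣m; gcd[m,n]∣n; gcd[m,n]≡0⇒m≡0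
    ; c*gcd[m,n]≡gcd[cm,cn]; module Bézout)
open import Data.Nat.Primality
  using (Prime; euclidsLemma; prime⇒nonTrivial; prime⇒nonZero; ¬prime[0])
open import Data.Nat.Properties using (m^n≢0; m*n≢0)
import Data.Nat.Properties as ℕ
open import Data.Nat.Solver using (module +-*-Solver)
open import Data.Product.Base using (∃; _×_; _,_; proj₁; proj₂)
open import Data.Rational.Base as ℚ using (ℚ; 1ℚ)
import Data.Rational.Properties as ℚ
open import Data.Rational.Unnormalised.Base as ℚᵘ using (mkℚᵘ; *≡*)
import Data.Rational.Unnormalised.Properties as ℚᵘ
open import Data.Sum.Base using (_⊎_; inj₁; inj₂; [_,_]′)
open import Data.Vec.Base using (count; tabulate)
open import Defs
open import Function.Base using (_∘_; id; it)
open import Function.Bundles using (Inverse)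
open import Level using (_⊔_)
open import Relation.Binary.Core using (_Preserves_⟶_)
open import Relation.Binary.PropositionalEquality
  using (_≡_; _≢_; refl; sym; trans; cong; cong₂; subst; subst₂; module ≡-Reasoning)
open import Relation.Nullary.Decidable using (Dec; yes; no; does; ¬?; _×-dec_; dec-true; dec-false)
open import Relation.Nullary.Negation using (¬_; contradiction)
open import Relation.Unary using (Pred; Decidable)

open import Algebra.Properties.Semiring.Sum ℕ.+-*-semiring
  using (sum; sum-cong-≗; sum-replicate-zero; ∑-distrib-+; ∑-comm; *-distribˡ-sum)

-- Counting by sums of indicators

-- Put y(u) = u^A - 1, so that Λ(u) = u y(u)^h. If Λ(v) = Λ(u) is nonzero, then v = u w^h with w =
-- y(u) / y(v), and h A = N - 1 gives v^A = a w^(N-1). Substituted into w y(v) = y(u), this becomes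
-- a w^N - w = a - 1, an affine equation with the solution w = 1; hence w = 1 + z with z in the
-- kernel. The zero fibre stands apart: every u with u^A = 1 has solutions z (one is z = 1), but Λ
-- vanishes there. The number d = gcd(A, s - 1) of these u is removed before the other u with
-- solutions are grouped into fibres of s points, and d h = κ (s - 1) brings κ into the formulas.
-- Roots of unity are counted by bounding the number of roots of monic polynomial functions, without
-- appeal to the cyclicity of the multiplicative group. The numbers of fibres come from identities
-- between natural numbers; fractions enter only at the end.

indicator : ∀ {a} {A : Set a} → Dec A → ℕ
indicator d = if does d then 1 else 0

indicator-cong : ∀ {a b} {A : Set a} {B : Set b} (A? : Dec A) (B? : Dec B) →
                 (A → B) → (B → A) → indicator A? ≡ indicator B?
indicator-cong (yes x) B? f g rewrite dec-true B? (f x) = refl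
indicator-cong (no ¬x) B? f g rewrite dec-false B? (¬x ∘ g) = refl

indicator-× : ∀ {a b} {A : Set a} {B : Set b} (A? : Dec A) (B? : Dec B) →
              indicator (A? ×-dec B?) ≡ indicator A? * indicator B?
indicator-× A? B? with does A? | does B?
... | true  | true  = refl
... | true  | false = refl
... | false | _     = refl

*-indicator : ∀ {a} {A : Set a} {k n} (A? : Dec A) → (A → n ≡ k) → (¬ A → n ≡ 0) → k * indicator A? ≡ n
*-indicator {k = k} (yes x) n≡k _ = trans (ℕ.*-identityʳ k) (sym (n≡k x))
*-indicator {k = k} (no ¬x) _ n≡0 = trans (ℕ.*-zeroʳ k) (sym (n≡0 ¬x))

indicator-⊎-≤ : ∀ {a b c} {A : Set a} {B : Set b} {C : Set c} (A? : Dec A) (B? : Dec B) (C? : Dec C) →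
                (A → B ⊎ C) → indicator A? ≤ indicator B? + indicator C?
indicator-⊎-≤ (no _)  B? C? f = z≤n
indicator-⊎-≤ (yes x) B? C? f with f x
... | inj₁ y rewrite dec-true B? y = s≤s z≤n
... | inj₂ z rewrite dec-true C? z = ℕ.m≤n+m 1 _

indicator-⊎ : ∀ {a b c} {A : Set a} {B : Set b} {C : Set c} (A? : Dec A) (B? : Dec B) (C? : Dec C) →
              (A → B ⊎ C) → (B → A) → (C → A) → (B → ¬ C) →
              indicator A? ≡ indicator B? + indicator C?
indicator-⊎ (no ¬x) B? C? f g h _ rewrite dec-false B? (¬x ∘ g) | dec-false C? (¬x ∘ h) = refl
indicator-⊎ (yes x) B? C? f g h disjoint with f x
... | inj₁ y rewrite dec-true B? y | dec-false C? (disjoint y) = refl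
... | inj₂ z rewrite dec-true C? z | dec-false B? (λ y → disjoint y z) = refl

sum-mono-≤ : ∀ {n} (f g : Fin n → ℕ) → (∀ i → f i ≤ g i) → sum f ≤ sum g
sum-mono-≤ {zero}  f g f≤g = z≤n
sum-mono-≤ {suc n} f g f≤g = ℕ.+-mono-≤ (f≤g zero) (sum-mono-≤ (f ∘ suc) (g ∘ suc) (f≤g ∘ suc))

sum-zero : ∀ {n} (f : Fin n → ℕ) → (∀ i → f i ≡ 0) → sum f ≡ 0
sum-zero {n} f f≗0 = trans (sum-cong-≗ f≗0) (sum-replicate-zero n)

sum-indicator-≡ : ∀ {n} (k : Fin n) → sum (λ i → indicator (i Fin.≟ k)) ≡ 1
sum-indicator-≡ {suc n} zero = cong suc (sum-zero {n} (λ i → indicator (suc i Fin.≟ zero)) λ _ → refl)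
sum-indicator-≡ (suc k) = trans
  (sum-cong-≗ λ i → indicator-cong (suc i Fin.≟ suc k) (i Fin.≟ k) Fin.suc-injective (cong suc))
  (sum-indicator-≡ k)

count-tabulate : ∀ {a p} {A : Set a} {P : Pred A p} (P? : Decidable P) {n} (f : Fin n → A) →
                 count P? (tabulate f) ≡ sum (indicator ∘ P? ∘ f)
count-tabulate P? {zero}  f = refl
count-tabulate P? {suc n} f with does (P? (f zero))
... | true  = cong suc (count-tabulate P? (f ∘ suc))
... | false = count-tabulate P? (f ∘ suc)

module Counting {c ℓ₁ ℓ₂ q} (F : FiniteField c ℓ₁ ℓ₂ q) where

  open FiniteField F
  open CommutativeRing commutativeRing using () renaming (sym to ≈-sym; trans to ≈-trans)

  ∑ : (Carrier → ℕ) → ℕ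
  ∑ f = sum (f ∘ element)

  ∑-cong : ∀ {f g : Carrier → ℕ} → (∀ x → f x ≡ g x) → ∑ f ≡ ∑ g
  ∑-cong f≗g = sum-cong-≗ (f≗g ∘ element)

  ∑-swap : ∀ (f : Carrier → Carrier → ℕ) → ∑ (λ x → ∑ (f x)) ≡ ∑ (λ y → ∑ (λ x → f x y))
  ∑-swap f = ∑-comm (λ i j → f (element i) (element j))

  ∑-*ˡ : ∀ k f → ∑ (λ x → k * f x) ≡ k * ∑ f
  ∑-*ˡ k f = sym (*-distribˡ-sum k (f ∘ element))

  module _ {a} {P : Pred Carrier a} (P? : Decidable P) where

    #≡∑ : #[ P? ] ≡ ∑ (indicator ∘ P?)
    #≡∑ = count-tabulate P? element

    #-none : (∀ x → ¬ P x) → #[ P? ] ≡ 0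
    #-none ¬P = trans #≡∑ (sum-zero _ λ i → cong (if_then 1 else 0) (dec-false (P? (element i)) (¬P _)))

    #-all : (∀ x → P x) → #[ P? ] ≡ q
    #-all ∀P = trans #≡∑ (trans
      (sum-cong-≗ λ i → cong (if_then 1 else 0) (dec-true (P? (element i)) (∀P _))) (sum-1 q))
      where
      sum-1 : ∀ n → sum {n} (λ _ → 1) ≡ n
      sum-1 zero    = refl
      sum-1 (suc n) = cong suc (sum-1 n)

    -- The search visits only the representatives `element i`; invariance under `_≈_` lets it stand
    -- for a search of the whole carrier.
    ∃-dec : (∀ {x y} → x ≈ y → P x → P y) → Dec (∃ P)
    ∃-dec resp with Fin.any? (P? ∘ element)
    ... | yes (i , Pi) = yes (element i , Pi)
    ... | no ¬∃ = no λ (x , Px) → ¬∃ (index x , resp (≈-sym (element-index x)) Px)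

  module _ {a b} {P : Pred Carrier a} {R : Pred Carrier b} (P? : Decidable P) (R? : Decidable R) where

    #-cong : (∀ x → P x → R x) → (∀ x → R x → P x) → #[ P? ] ≡ #[ R? ]
    #-cong f g = trans (#≡∑ P?)
      (trans (∑-cong λ x → indicator-cong (P? x) (R? x) (f x) (g x)) (sym (#≡∑ R?)))

  module _ {a b d} {P : Pred Carrier a} {R : Pred Carrier b} {S : Pred Carrier d}
           (P? : Decidable P) (R? : Decidable R) (S? : Decidable S) where

    #-⊎-≤ : (∀ x → P x → R x ⊎ S x) → #[ P? ] ≤ #[ R? ] + #[ S? ]
    #-⊎-≤ f = subst₂ _≤_ (sym (#≡∑ P?))
      (trans (∑-distrib-+ (indicator ∘ R? ∘ element) _) (sym (cong₂ _+_ (#≡∑ R?) (#≡∑ S?))))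
      (sum-mono-≤ (indicator ∘ P? ∘ element) _ λ i → indicator-⊎-≤ (P? _) (R? _) (S? _) (f _))

    #-⊎ : (∀ x → P x → R x ⊎ S x) → (∀ x → R x → P x) → (∀ x → S x → P x) → (∀ x → R x → ¬ S x) →
          #[ P? ] ≡ #[ R? ] + #[ S? ]
    #-⊎ f g h disjoint = trans (#≡∑ P?) (trans
      (∑-cong λ x → indicator-⊎ (P? x) (R? x) (S? x) (f x) (g x) (h x) (disjoint x)) (trans
      (∑-distrib-+ (indicator ∘ R? ∘ element) _)
      (sym (cong₂ _+_ (#≡∑ R?) (#≡∑ S?)))))

  #-≈ : ∀ x → #[ (_≟ᶠ x) ] ≡ 1
  #-≈ x = trans (#≡∑ (_≟ᶠ x)) (trans
    (sum-cong-≗ λ i → indicator-cong (element i ≟ᶠ x) (i Fin.≟ index x)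
      (λ eq → trans (sym (index-element i)) (index-cong eq))
      (λ eq → ≈-trans (element-cong eq) (element-index x)))
    (sum-indicator-≡ (index x)))
    where
    open Inverse enumeration using () renaming (strictlyInverseʳ to index-element)

  ∑-point : ∀ k x → ∑ (λ y → k * indicator (y ≟ᶠ x)) ≡ k
  ∑-point k x = trans (∑-*ˡ k λ y → indicator (y ≟ᶠ x)) (trans
    (cong (k *_) (trans (sym (#≡∑ (_≟ᶠ x))) (#-≈ x))) (ℕ.*-identityʳ k))

  module _ {a b} {P : Pred Carrier a} {R : Pred Carrier b} (P? : Decidable P) (R? : Decidable R) where

    private
      #≡∑∑ : ∀ {d} {S : Pred Carrier d} (S? : Decidable S) (f : Carrier → Carrier) →
             #[ S? ] ≡ ∑ (λ x → ∑ (λ y → indicator (S? x ×-dec (y ≟ᶠ f x))))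
      #≡∑∑ S? f = trans (#≡∑ S?) (∑-cong λ x → sym (trans
        (∑-cong λ y → indicator-× (S? x) (y ≟ᶠ f x)) (∑-point (indicator (S? x)) (f x))))

    -- The graph of `f` over `P` and the transposed graph of `g` over `R` are the same set of pairs;
    -- the two orders of summation count it as `P` and as `R`.
    #-bijection : (f g : Carrier → Carrier) → f Preserves _≈_ ⟶ _≈_ → g Preserves _≈_ ⟶ _≈_ →
                  (∀ {x y} → x ≈ y → P x → P y) → (∀ {x y} → x ≈ y → R x → R y) →
                  (∀ x → P x → R (f x)) → (∀ y → R y → P (g y)) →
                  (∀ x → P x → g (f x) ≈ x) → (∀ y → R y → f (g y) ≈ y) →
                  #[ P? ] ≡ #[ R? ]
    #-bijection f g f-cong g-cong P-resp R-resp P⇒R R⇒P gf fg = trans (#≡∑∑ P? f) (trans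
      (∑-swap λ x y → indicator (P? x ×-dec (y ≟ᶠ f x))) (trans
      (∑-cong λ y → ∑-cong λ x → indicator-cong (P? x ×-dec (y ≟ᶠ f x)) (R? y ×-dec (x ≟ᶠ g y))
        (λ (Px , y≈fx) → R-resp (≈-sym y≈fx) (P⇒R x Px) , ≈-trans (≈-sym (gf x Px)) (g-cong (≈-sym y≈fx)))
        (λ (Ry , x≈gy) → P-resp (≈-sym x≈gy) (R⇒P y Ry) , ≈-trans (≈-sym (fg y Ry)) (f-cong (≈-sym x≈gy))))
      (sym (#≡∑∑ R? g))))

  -- Exchanging the sums counts the pairs (t, u) with f(u) = t by u, and each u meets exactly one t.
  ∑-fibres : ∀ {a} {T : Pred Carrier a} (T? : Decidable T) (f : Carrier → Carrier) →
             (∀ {x y} → x ≈ y → T x → T y) →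
             ∑ (λ t → indicator (T? t) * #[ (λ u → f u ≟ᶠ t) ]) ≡ #[ (λ u → T? (f u)) ]
  ∑-fibres {T = T} T? f T-resp = trans
    (∑-cong λ t → trans (cong (indicator (T? t) *_) (#≡∑ λ u → f u ≟ᶠ t))
                        (sym (∑-*ˡ (indicator (T? t)) (λ u → indicator (f u ≟ᶠ t))))) (trans
    (∑-swap λ t u → indicator (T? t) * indicator (f u ≟ᶠ t)) (trans
    (∑-cong λ u → trans (∑-cong (pointwise u)) (∑-point (indicator (T? (f u))) (f u)))
    (sym (#≡∑ λ u → T? (f u)))))
    where
    pointwise : ∀ u t → indicator (T? t) * indicator (f u ≟ᶠ t) ≡ indicator (T? (f u)) * indicator (t ≟ᶠ f u)
    pointwise u t = trans (sym (indicator-× (T? t) (f u ≟ᶠ t))) (trans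
      (indicator-cong (T? t ×-dec (f u ≟ᶠ t)) (T? (f u) ×-dec (t ≟ᶠ f u))
        (λ (Tt , eq) → T-resp (≈-sym eq) Tt , ≈-sym eq) (λ (Tt , eq) → T-resp (≈-sym eq) Tt , ≈-sym eq))
      (indicator-× (T? (f u)) (t ≟ᶠ f u)))

  *-#-fibres : ∀ {a} {T : Pred Carrier a} (T? : Decidable T) (f : Carrier → Carrier) (k : ℕ) →
               (∀ {x y} → x ≈ y → T x → T y) →
               (∀ t → T t → #[ (λ u → f u ≟ᶠ t) ] ≡ k) →
               k * #[ T? ] ≡ #[ (λ u → T? (f u)) ]
  *-#-fibres T? f k T-resp fibre = trans (cong (k *_) (#≡∑ T?)) (trans
    (sym (∑-*ˡ k (indicator ∘ T?))) (trans
    (∑-cong pointwise)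
    (∑-fibres T? f T-resp)))
    where
    pointwise : ∀ t → k * indicator (T? t) ≡ indicator (T? t) * #[ (λ u → f u ≟ᶠ t) ]
    pointwise t with T? t
    ... | yes Tt = trans (ℕ.*-comm k 1) (cong (1 *_) (sym (fibre t Tt)))
    ... | no _ = ℕ.*-zeroʳ k

-- Prime exponents, roots of unity and monic polynomial functions in a commutative semiring

prime∤! : ∀ {p k} → Prime p → k < p → p ∤ k !
prime∤! {p} {zero} pp 0<p p∣1 with ∣1⇒≡1 p∣1
... | refl = nonTrivial⇒≢1 {{prime⇒nonTrivial pp}} refl
prime∤! {p} {suc k} pp k<p p∣ with euclidsLemma (suc k) (k !) pp p∣
... | inj₁ p∣1+k = >⇒∤ k<p p∣1+k
... | inj₂ p∣k!  = prime∤! pp (ℕ.<-trans (ℕ.n<1+n k) k<p) p∣k!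

-- p divides p! = k! (p-k)! C(p,k), but neither factorial, as both are products of numbers below p.
prime∣C : ∀ {p k} → Prime p → 0 < k → k < p → p ∣ p ℕ.C k
prime∣C {zero} pp = contradiction pp ¬prime[0]
prime∣C {p@(suc p′)} {k} pp 0<k k<p =
  [ (λ p∣k![p-k]! → contradiction p∣k![p-k]! p∤k![p-k]!) , id ]′
  (euclidsLemma (k ! * (p ∸ k) !) (p ℕ.C k) pp
    (subst (p ∣_) (sym p!) (m∣m*n (p′ !))))
  where
  k≤p = ℕ.<⇒≤ k<p
  instance _ = ℕ._!*_!≢0 k (p ∸ k)
  p∤k![p-k]! : p ∤ k ! * (p ∸ k) !
  p∤k![p-k]! = [ prime∤! pp k<p , prime∤! pp (ℕ.∸-monoʳ-< 0<k k≤p) ]′ ∘ euclidsLemma (k !) _ pp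
  p! : k ! * (p ∸ k) ! * (p ℕ.C k) ≡ p !
  p! = trans (cong (k ! * (p ∸ k) ! *_) (nCk≡n!/k![n-k]! k≤p)) (m*[n/m]≡n (k![n∸k]!∣n! k≤p))

module Semirings {c ℓ} (S : CommutativeSemiring c ℓ) where

  open CommutativeSemiring S
    renaming (_+_ to _⊕_; _*_ to _⊗_; refl to ≈-refl; sym to ≈-sym; trans to ≈-trans; zero to ⊗-zero)
  open import Algebra.Properties.CommutativeSemiring.Exp S renaming (_^_ to _^ᶠ_)
  open import Algebra.Properties.Semiring.Mult semiring renaming (_×_ to _×ᶠ_)
  open import Algebra.Properties.Semiring.Sum semiring using (sum-cong-≋; sum-init-last)
    renaming (sum to ∑ᶠ; sum-replicate-zero to ∑ᶠ-replicate-zero)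
  open import Algebra.Properties.CommutativeSemiring.Binomial S using (theorem; binomialTerm)
  open import Algebra.Solver.Ring.NaturalCoefficients.Default S
  open import Relation.Binary.Reasoning.Setoid setoid

  ∣⇒×≈0 : ∀ {p n} → p ×ᶠ 1# ≈ 0# → p ∣ n → ∀ x → n ×ᶠ x ≈ 0#
  ∣⇒×≈0 {p} {n} p×1≈0 (divides k n≡kp) x = begin
    n ×ᶠ x                ≈⟨ ×-cong n≡kp (≈-sym (*-identityˡ x)) ⟩
    (k * p) ×ᶠ (1# ⊗ x)   ≈⟨ ×-assoc-* (k * p) 1# x ⟨
    (k * p) ×ᶠ 1# ⊗ x     ≈⟨ *-congʳ (×1-homo-* k p) ⟩
    k ×ᶠ 1# ⊗ p ×ᶠ 1# ⊗ x ≈⟨ *-congʳ (≈-trans (*-congˡ p×1≈0) (zeroʳ _)) ⟩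
    0# ⊗ x                ≈⟨ zeroˡ x ⟩
    0#                    ∎

  -- The inner binomial coefficients of a prime exponent vanish.
  ^p-distrib-+ : ∀ {p} → Prime p → p ×ᶠ 1# ≈ 0# → ∀ x y → (x ⊕ y) ^ᶠ p ≈ x ^ᶠ p ⊕ y ^ᶠ p
  ^p-distrib-+ {zero} pp = contradiction pp ¬prime[0]
  ^p-distrib-+ {p@(suc p′)} pp p×1≈0 x y = begin
    (x ⊕ y) ^ᶠ p  ≈⟨ theorem p x y ⟩
    t zero ⊕ ∑ᶠ (t ∘ suc) ≈⟨ +-congˡ (sum-init-last (t ∘ suc)) ⟩
    t zero ⊕ (∑ᶠ inner ⊕ t (fromℕ p)) ≈⟨ +-cong first (+-cong inner≈0 last) ⟩
    y ^ᶠ p ⊕ (0# ⊕ x ^ᶠ p) ≈⟨ +-congˡ (+-identityˡ _) ⟩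
    y ^ᶠ p ⊕ x ^ᶠ p ≈⟨ +-comm _ _ ⟩
    x ^ᶠ p ⊕ y ^ᶠ p ∎
    where
    t = binomialTerm x y p
    inner : Fin p′ → Carrier
    inner i = t (suc (inject₁ i))
    first : t zero ≈ y ^ᶠ p
    first = ≈-trans (×-homo-1 _) (*-identityˡ _)
    last : t (fromℕ p) ≈ x ^ᶠ p
    last = begin
      (p ℕ.C toℕ (fromℕ p)) ×ᶠ (x ^ᶠ toℕ (fromℕ p) ⊗ y ^ᶠ (p ∸ toℕ (fromℕ p)))
        ≡⟨ cong (λ k → (p ℕ.C k) ×ᶠ (x ^ᶠ k ⊗ y ^ᶠ (p ∸ k))) (Fin.toℕ-fromℕ p) ⟩
      (p ℕ.C p) ×ᶠ (x ^ᶠ p ⊗ y ^ᶠ (p ∸ p))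
        ≡⟨ cong₂ (λ k l → k ×ᶠ (x ^ᶠ p ⊗ y ^ᶠ l)) (nCn≡1 p) (ℕ.n∸n≡0 p) ⟩
      1 ×ᶠ (x ^ᶠ p ⊗ 1#) ≈⟨ ×-homo-1 _ ⟩
      x ^ᶠ p ⊗ 1# ≈⟨ *-identityʳ _ ⟩
      x ^ᶠ p ∎
    inner≈0 : ∑ᶠ inner ≈ 0#
    inner≈0 = ≈-trans
      (sum-cong-≋ λ i → ∣⇒×≈0 p×1≈0
        (prime∣C pp (s≤s z≤n) (s≤s (subst (_< p′) (sym (Fin.toℕ-inject₁ i)) (Fin.toℕ<n i)))) _)
      (∑ᶠ-replicate-zero p′)

  ^p^e-distrib-+ : ∀ {p} → Prime p → p ×ᶠ 1# ≈ 0# → ∀ e x y →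
                   (x ⊕ y) ^ᶠ (p ^ e) ≈ x ^ᶠ (p ^ e) ⊕ y ^ᶠ (p ^ e)
  ^p^e-distrib-+ pp p×1≈0 zero x y = ≈-trans (*-identityʳ _) (+-cong (≈-sym (*-identityʳ x)) (≈-sym (*-identityʳ y)))
  ^p^e-distrib-+ {p} pp p×1≈0 (suc e) x y = begin
    (x ⊕ y) ^ᶠ (p * p ^ e) ≈⟨ ^-assocʳ (x ⊕ y) p (p ^ e) ⟨
    ((x ⊕ y) ^ᶠ p) ^ᶠ (p ^ e) ≈⟨ ^-congˡ (p ^ e) (^p-distrib-+ pp p×1≈0 x y) ⟩
    (x ^ᶠ p ⊕ y ^ᶠ p) ^ᶠ (p ^ e) ≈⟨ ^p^e-distrib-+ pp p×1≈0 e _ _ ⟩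
    (x ^ᶠ p) ^ᶠ (p ^ e) ⊕ (y ^ᶠ p) ^ᶠ (p ^ e) ≈⟨ +-cong (^-assocʳ x p _) (^-assocʳ y p _) ⟩
    x ^ᶠ (p * p ^ e) ⊕ y ^ᶠ (p * p ^ e) ∎

  1^n≈1 : ∀ n → 1# ^ᶠ n ≈ 1#
  1^n≈1 zero    = ≈-refl
  1^n≈1 (suc n) = ≈-trans (*-identityˡ _) (1^n≈1 n)

  ^-∣-≈1 : ∀ {x m n} → m ∣ n → x ^ᶠ m ≈ 1# → x ^ᶠ n ≈ 1#
  ^-∣-≈1 {x} {m} {n} (divides k n≡km) x^m≈1 = begin
    x ^ᶠ n        ≡⟨ cong (x ^ᶠ_) (trans n≡km (ℕ.*-comm k m)) ⟩
    x ^ᶠ (m * k)  ≈⟨ ^-assocʳ x m k ⟨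
    (x ^ᶠ m) ^ᶠ k ≈⟨ ^-congˡ k x^m≈1 ⟩
    1# ^ᶠ k       ≈⟨ 1^n≈1 k ⟩
    1#            ∎

  -- Horner form indexed by the degree. Only the values of a polynomial matter here, so a function
  -- together with pointwise equations replaces a list of coefficients.
  data Monic : ℕ → (Carrier → Carrier) → Set (c ⊔ ℓ) where
    unit : ∀ {f} → (∀ x → f x ≈ 1#) → Monic 0 f
    step : ∀ {n f g} a → Monic n g → (∀ x → f x ≈ a ⊕ x ⊗ g x) → Monic (suc n) f

  Monic-cong : ∀ {n f} → Monic n f → f Preserves _≈_ ⟶ _≈_
  Monic-cong (unit f≈1) x≈y = ≈-trans (f≈1 _) (≈-sym (f≈1 _))
  Monic-cong (step a g-monic f≈) x≈y = ≈-trans (f≈ _)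
    (≈-trans (+-congˡ (*-cong x≈y (Monic-cong g-monic x≈y))) (≈-sym (f≈ _)))

  -- f x - f a = (x - a) q x, rearranged so that no subtraction occurs.
  Monic-divide : ∀ {n f} → Monic (suc n) f → ∀ a →
                 ∃ λ q → Monic n q × (∀ x → f x ⊕ a ⊗ q x ≈ f a ⊕ x ⊗ q x)
  Monic-divide {zero} {f} (step {g = g} b (unit g≈1) f≈) a = (λ _ → 1#) , unit (λ _ → ≈-refl) , λ x → begin
    f x ⊕ a ⊗ 1#                ≈⟨ +-congʳ (≈-trans (f≈ x) (+-congˡ (*-congˡ (g≈1 x)))) ⟩
    b ⊕ x ⊗ 1# ⊕ a ⊗ 1#         ≈⟨ solve 3 (λ u v w → u :+ v :+ w := u :+ w :+ v) ≈-refl b _ _ ⟩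
    b ⊕ a ⊗ 1# ⊕ x ⊗ 1#         ≈⟨ +-congʳ (≈-trans (f≈ a) (+-congˡ (*-congˡ (g≈1 a)))) ⟨
    f a ⊕ x ⊗ 1#                ∎
  Monic-divide {suc n} {f} (step {g = g} b g-monic f≈) a with Monic-divide g-monic a
  -- Synthetic division: x g(x) - a g(a) = (x - a) g(a) + x (g(x) - g(a)), and the last difference
  -- is (x - a) q(x) by induction.
  ... | q , q-monic , g≈ = (λ x → g a ⊕ x ⊗ q x) , step (g a) q-monic (λ _ → ≈-refl) , λ x → begin
    f x ⊕ a ⊗ (g a ⊕ x ⊗ q x)           ≈⟨ +-congʳ (f≈ x) ⟩
    b ⊕ x ⊗ g x ⊕ a ⊗ (g a ⊕ x ⊗ q x)
      ≈⟨ solve 6 (λ b x gx a ga qx → b :+ x :* gx :+ a :* (ga :+ x :* qx) := b :+ a :* ga :+ x :* (gx :+ a :* qx)) ≈-refl b x (g x) a (g a) (q x) ⟩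
    b ⊕ a ⊗ g a ⊕ x ⊗ (g x ⊕ a ⊗ q x)   ≈⟨ +-cong (≈-sym (f≈ a)) (*-congˡ (g≈ x)) ⟩
    f a ⊕ x ⊗ (g a ⊕ x ⊗ q x)           ∎

  Monic-^* : ∀ k {n f} → Monic n f → Monic (k + n) (λ x → x ^ᶠ k ⊗ f x)
  Monic-^* zero (unit f≈1) = unit λ x → ≈-trans (*-identityˡ _) (f≈1 x)
  Monic-^* zero (step a g-monic f≈) = step a g-monic λ x → ≈-trans (*-identityˡ _) (f≈ x)
  Monic-^* (suc k) f-monic = step 0# (Monic-^* k f-monic) λ x → ≈-trans (*-assoc _ _ _) (≈-sym (+-identityˡ _))

  Monic-+ : ∀ {n f} a → Monic (suc n) f → Monic (suc n) (λ x → a ⊕ f x)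
  Monic-+ a (step b g-monic f≈) = step (a ⊕ b) g-monic λ x → ≈-trans (+-congˡ (f≈ x)) (≈-sym (+-assoc _ _ _))

  geometric : ℕ → ℕ → Carrier → Carrier
  geometric k zero    x = 1#
  geometric k (suc j) x = 1# ⊕ x ^ᶠ k ⊗ geometric k j x

  geometric-monic : ∀ k → .{{NonZero k}} → ∀ j → Monic (j * k) (geometric k j)
  geometric-monic k       zero    = unit λ _ → ≈-refl
  geometric-monic (suc k) (suc j) = Monic-+ 1# (Monic-^* (suc k) (geometric-monic (suc k) j))

  -- This is (x^k - 1) G = x^((j+1)k) - 1 with the negative terms moved to the opposite sides.
  geometric-sum : ∀ k j x → x ^ᶠ (suc j * k) ⊕ geometric k j x ≈ 1# ⊕ x ^ᶠ k ⊗ geometric k j x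
  geometric-sum k zero x = begin
    x ^ᶠ (k + 0) ⊕ 1# ≡⟨ cong (λ n → x ^ᶠ n ⊕ 1#) (ℕ.+-identityʳ k) ⟩
    x ^ᶠ k ⊕ 1#       ≈⟨ +-comm _ _ ⟩
    1# ⊕ x ^ᶠ k       ≈⟨ +-congˡ (*-identityʳ _) ⟨
    1# ⊕ x ^ᶠ k ⊗ 1#  ∎
  geometric-sum k (suc j) x = begin
    x ^ᶠ (k + suc j * k) ⊕ (1# ⊕ y ⊗ G)     ≈⟨ +-congʳ (^-homo-* x k (suc j * k)) ⟩
    y ⊗ z ⊕ (1# ⊕ y ⊗ G)                     ≈⟨ solve 3 (λ y z G → y :* z :+ (con 1 :+ y :* G) := con 1 :+ y :* (z :+ G)) ≈-refl y z G ⟩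
    1# ⊕ y ⊗ (z ⊕ G)                         ≈⟨ +-congˡ (*-congˡ (geometric-sum k j x)) ⟩
    1# ⊕ y ⊗ (1# ⊕ y ⊗ G)                    ∎
    where
    y = x ^ᶠ k
    z = x ^ᶠ (suc j * k)
    G = geometric k j x

-- Finite fields

suc[n∸1]≡n : ∀ n → .{{NonZero (n ∸ 1)}} → suc (n ∸ 1) ≡ n
suc[n∸1]≡n (suc n) = refl

module FiniteFieldProperties {c ℓ₁ ℓ₂ q} (F : FiniteField c ℓ₁ ℓ₂ q) where

  open FiniteField F hiding (setoid; semiring) public
  open Counting F public
  open CommutativeRing commutativeRing public
    hiding (Carrier; _≈_; _≉_; 0#; 1#)
    renaming (_+_ to _⊕_; _*_ to _⊗_; -_ to ⊖_; refl to ≈-refl; sym to ≈-sym; trans to ≈-trans; zero to ⊗-zero)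
  open Semirings commutativeSemiring public
  open import Algebra.Properties.CommutativeSemiring.Exp commutativeSemiring public
    using (^-congˡ; ^-homo-*; ^-assocʳ; ^-distrib-*)
  open import Algebra.Properties.Semiring.Mult semiring using (×1-homo-*) renaming (_×_ to _×ᶠ_)
  open import Algebra.Properties.Ring ring public using (+-cancelˡ; +-cancelʳ)
  open import Relation.Binary.Reasoning.Setoid setoid
  private module H = HeytingField heytingField

  x-0≈x : ∀ x → x -ᶠ 0# ≈ x
  x-0≈x x = +-cancelʳ 0# _ _ (≈-trans (+-assoc _ _ _) (+-congˡ (-‿inverseˡ 0#)))

  1≉0 : 1# ≉ 0#
  1≉0 1≈0 = proj₂ (H.tight 1# 0#) 1≈0
    (H.invertible⇒# (1# , ≈-trans (*-identityˡ _) (x-0≈x 1#) , ≈-trans (*-identityʳ _) (x-0≈x 1#)))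

  -- Tightness turns `x ≉ 0#` only into the double negation of apartness from `0#`. Finite search
  -- decides whether an inverse exists, and so extracts a witness from it.
  inverse : ∀ {x} → x ≉ 0# → ∃ λ y → x ⊗ y ≈ 1#
  inverse {x} x≉0 with ∃-dec (λ y → x ⊗ y ≟ᶠ 1#) (λ y≈z xy≈1 → ≈-trans (*-congˡ (≈-sym y≈z)) xy≈1)
  ... | yes x⁻¹ = x⁻¹
  ... | no ¬∃ = contradiction (proj₁ (H.tight x 0#) λ x#0 →
      let y , _ , [x-0]y≈1 = H.#⇒invertible x#0
      in ¬∃ (y , ≈-trans (*-congʳ (≈-sym (x-0≈x x))) [x-0]y≈1)) x≉0

  ⊗-cancelˡ : ∀ {x y z} → x ≉ 0# → x ⊗ y ≈ x ⊗ z → y ≈ z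
  ⊗-cancelˡ {x} {y} {z} x≉0 xy≈xz with inverse x≉0
  ... | x⁻¹ , xx⁻¹≈1 = begin
    y             ≈⟨ undo y ⟨
    x⁻¹ ⊗ (x ⊗ y) ≈⟨ *-congˡ xy≈xz ⟩
    x⁻¹ ⊗ (x ⊗ z) ≈⟨ undo z ⟩
    z ∎
    where
    undo : ∀ w → x⁻¹ ⊗ (x ⊗ w) ≈ w
    undo w = ≈-trans (≈-sym (*-assoc _ _ _)) (≈-trans (*-congʳ (≈-trans (*-comm _ _) xx⁻¹≈1)) (*-identityˡ w))

  xy≈0⇒x≈0⊎y≈0 : ∀ x y → x ⊗ y ≈ 0# → x ≈ 0# ⊎ y ≈ 0#
  xy≈0⇒x≈0⊎y≈0 x y xy≈0 with x ≟ᶠ 0#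
  ... | yes x≈0 = inj₁ x≈0
  ... | no x≉0  = inj₂ (⊗-cancelˡ x≉0 (≈-trans xy≈0 (≈-sym (zeroʳ x))))

  ⊗-≉0 : ∀ {x y} → x ≉ 0# → y ≉ 0# → x ⊗ y ≉ 0#
  ⊗-≉0 {x} {y} x≉0 y≉0 xy≈0 = [ x≉0 , y≉0 ]′ (xy≈0⇒x≈0⊎y≈0 x y xy≈0)

  ^-≉0 : ∀ {x} n → x ≉ 0# → x ^ᶠ n ≉ 0#
  ^-≉0 zero    x≉0 = 1≉0
  ^-≉0 (suc n) x≉0 = ⊗-≉0 x≉0 (^-≉0 n x≉0)

  0^n≈0 : ∀ n → .{{NonZero n}} → 0# ^ᶠ n ≈ 0#
  0^n≈0 (suc n) = zeroˡ _

  ≉0? : Decidable (_≉ 0#)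
  ≉0? x = ¬? (x ≟ᶠ 0#)

  #≉0 : #[ ≉0? ] ≡ q ∸ 1
  #≉0 = cong (_∸ 1) (trans (cong (_+ #[ ≉0? ]) (sym (#-≈ 0#))) (trans
    (sym (#-⊎ (λ _ → yes ≈-refl) (_≟ᶠ 0#) ≉0? (λ x _ → dichotomy x) (λ _ _ → ≈-refl) (λ _ _ → ≈-refl) (λ _ x≈0 x≉0 → x≉0 x≈0)))
    (#-all (λ _ → yes ≈-refl) (λ x → ≈-refl {x}))))
    where
    dichotomy : ∀ x → x ≈ 0# ⊎ x ≉ 0#
    dichotomy x with x ≟ᶠ 0#
    ... | yes x≈0 = inj₁ x≈0
    ... | no x≉0  = inj₂ x≉0

  instance
    -- Otherwise there would be no nonzero elements, although `1#` is one. The union bound is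
    -- applied with the set of nonzero elements taken twice, giving 1 ≤ 0 + 0.
    q∸1≢0 : NonZero (q ∸ 1)
    q∸1≢0 = ≢-nonZero λ q∸1≡0 → contradiction
      (subst₂ _≤_ (#-≈ 1#) (cong₂ _+_ (trans #≉0 q∸1≡0) (trans #≉0 q∸1≡0))
        (#-⊎-≤ (_≟ᶠ 1#) ≉0? ≉0? λ x x≈1 → inj₁ λ x≈0 → 1≉0 (≈-trans (≈-sym x≈1) x≈0)))
      λ ()

  -- Fermat's theorem and the characteristic

  open Inverse enumeration using () renaming (strictlyInverseʳ to index-element)

  inducedPermutation : (f g : Carrier → Carrier) → f Preserves _≈_ ⟶ _≈_ → g Preserves _≈_ ⟶ _≈_ →
                       (∀ x → f (g x) ≈ x) → (∀ x → g (f x) ≈ x) → Permutation′ q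
  inducedPermutation f g f-cong g-cong fg gf = permutation
    (index ∘ f ∘ element) (index ∘ g ∘ element) (round f-cong fg) (round g-cong gf)
    where
    round : ∀ {f g : Carrier → Carrier} → f Preserves _≈_ ⟶ _≈_ → (∀ x → f (g x) ≈ x) →
            ∀ i → index (f (element (index (g (element i))))) ≡ i
    round f-cong fg i =
      trans (index-cong (≈-trans (f-cong (element-index _)) (fg (element i)))) (index-element i)

  private
    module *-Sum = CommutativeMonoidSum *-commutativeMonoid
    module +-Sum = CommutativeMonoidSum +-commutativeMonoid
    open *-Sum using () renaming (sum to ∏)

  ∏-if : ∀ {a} {P : Pred Carrier a} (P? : Decidable P) x {n} (f : Fin n → Carrier) →
         ∏ (λ i → if does (P? (f i)) then x else 1#) ≈ x ^ᶠ count P? (tabulate f)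
  ∏-if P? x {zero} f = ≈-refl
  ∏-if P? x {suc n} f with does (P? (f zero))
  ... | true  = *-congˡ (∏-if P? x (f ∘ suc))
  ... | false = ≈-trans (*-identityˡ _) (∏-if P? x (f ∘ suc))

  ∏-≉0 : ∀ {n} (f : Fin n → Carrier) → (∀ i → f i ≉ 0#) → ∏ f ≉ 0#
  ∏-≉0 {zero}  f f≉0 = 1≉0
  ∏-≉0 {suc n} f f≉0 = ⊗-≉0 (f≉0 zero) (∏-≉0 (f ∘ suc) (f≉0 ∘ suc))

  -- Multiplication by x permutes the factors of the product of all nonzero elements.
  fermat : ∀ {x} → x ≉ 0# → x ^ᶠ (q ∸ 1) ≈ 1#
  fermat {x} x≉0 with inverse x≉0
  ... | x⁻¹ , xx⁻¹≈1 = ⊗-cancelˡ (∏-≉0 (w ∘ element) (w≉0 ∘ element)) (begin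
    ∏ (w ∘ element) ⊗ x ^ᶠ (q ∸ 1)          ≡⟨ cong (λ n → ∏ (w ∘ element) ⊗ x ^ᶠ n) #≉0 ⟨
    ∏ (w ∘ element) ⊗ x ^ᶠ #[ ≉0? ]         ≈⟨ *-congˡ (∏-if ≉0? x element) ⟨
    ∏ (w ∘ element) ⊗ ∏ (v ∘ element)       ≈⟨ *-Sum.∑-distrib-+ (w ∘ element) (v ∘ element) ⟨
    ∏ (λ i → w (element i) ⊗ v (element i)) ≈⟨ *-Sum.sum-cong-≋ {q} (λ i → w-scale (element i)) ⟨
    ∏ (λ i → w (element (index (x ⊗ element i)))) ≈⟨ *-Sum.sum-permute (w ∘ element) π ⟨
    ∏ (w ∘ element)                         ≈⟨ *-identityʳ _ ⟨
    ∏ (w ∘ element) ⊗ 1#                    ∎)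
    where
    -- `w` replaces zero by `1#`, so its product over all indices is the product of the nonzero
    -- elements; `v` contributes one factor x for each of these.
    v w : Carrier → Carrier
    v y = if does (≉0? y) then x else 1#
    w y = if does (≉0? y) then y else 1#
    if-≉0 : ∀ {y z} → y ≉ 0# → (if does (≉0? y) then z else 1#) ≡ z
    if-≉0 {y} y≉0 = cong (if_then _ else 1#) (dec-true (≉0? y) y≉0)
    if-≈0 : ∀ {y z} → y ≈ 0# → (if does (≉0? y) then z else 1#) ≡ 1#
    if-≈0 {y} y≈0 = cong (if_then _ else 1#) (dec-false (≉0? y) λ y≉0 → y≉0 y≈0)
    w≉0 : ∀ y → w y ≉ 0#
    w≉0 y with y ≟ᶠ 0#
    ... | yes y≈0 = subst (_≉ 0#) (sym (if-≈0 y≈0)) 1≉0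
    ... | no y≉0  = subst (_≉ 0#) (sym (if-≉0 y≉0)) y≉0
    w-scale : ∀ y → w (element (index (x ⊗ y))) ≈ w y ⊗ v y
    w-scale y with y ≟ᶠ 0#
    ... | yes y≈0 = begin
      w (element (index (x ⊗ y))) ≡⟨ if-≈0 (≈-trans (element-index _) (≈-trans (*-congˡ y≈0) (zeroʳ x))) ⟩
      1#                          ≈⟨ *-identityˡ 1# ⟨
      1# ⊗ 1#                     ≡⟨ cong₂ _⊗_ (if-≈0 y≈0) (if-≈0 y≈0) ⟨
      w y ⊗ v y                   ∎
    ... | no y≉0 = begin
      w (element (index (x ⊗ y))) ≡⟨ if-≉0 (λ xy≈0 → ⊗-≉0 x≉0 y≉0 (≈-trans (≈-sym (element-index _)) xy≈0)) ⟩
      element (index (x ⊗ y))     ≈⟨ element-index _ ⟩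
      x ⊗ y                       ≈⟨ *-comm x y ⟩
      y ⊗ x                       ≡⟨ cong₂ _⊗_ (if-≉0 y≉0) (if-≉0 y≉0) ⟨
      w y ⊗ v y                   ∎
    undo : ∀ {a b} → a ⊗ b ≈ 1# → ∀ z → a ⊗ (b ⊗ z) ≈ z
    undo ab≈1 z = ≈-trans (≈-sym (*-assoc _ _ z)) (≈-trans (*-congʳ ab≈1) (*-identityˡ z))
    π : Permutation′ q
    π = inducedPermutation (x ⊗_) (x⁻¹ ⊗_) *-congˡ *-congˡ
          (undo xx⁻¹≈1) (undo (≈-trans (*-comm _ _) xx⁻¹≈1))

  -- The inverse as the power x^(q-2), so that it respects _≈_; its value at 0# is junk.
  _⁻¹ : Carrier → Carrier
  x ⁻¹ = x ^ᶠ pred (q ∸ 1)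

  ⁻¹-cong : _⁻¹ Preserves _≈_ ⟶ _≈_
  ⁻¹-cong = ^-congˡ (pred (q ∸ 1))

  ⁻¹-inverseʳ : ∀ {x} → x ≉ 0# → x ⊗ x ⁻¹ ≈ 1#
  ⁻¹-inverseʳ {x} x≉0 = subst (λ n → x ^ᶠ n ≈ 1#) (sym (ℕ.suc-pred (q ∸ 1))) (fermat x≉0)

  x^q≈x : ∀ x → x ^ᶠ q ≈ x
  x^q≈x x = subst (λ n → x ^ᶠ n ≈ x) (suc[n∸1]≡n q) (x⊗x^[q∸1]≈x x)
    where
    x⊗x^[q∸1]≈x : ∀ x → x ⊗ x ^ᶠ (q ∸ 1) ≈ x
    x⊗x^[q∸1]≈x x with x ≟ᶠ 0#
    ... | yes x≈0 = ≈-trans (*-congʳ x≈0) (≈-trans (zeroˡ _) (≈-sym x≈0))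
    ... | no x≉0  = ≈-trans (*-congˡ (fermat x≉0)) (*-identityʳ x)

  -- Translation by `1#` permutes the field, so the sum of all elements is unchanged when q ones are
  -- added to it.
  q×1≈0 : q ×ᶠ 1# ≈ 0#
  q×1≈0 = +-cancelˡ (+-Sum.sum element) _ _ (begin
    +-Sum.sum element ⊕ q ×ᶠ 1#                  ≈⟨ +-congˡ (+-Sum.sum-replicate q) ⟨
    +-Sum.sum element ⊕ +-Sum.sum {q} (λ _ → 1#) ≈⟨ +-Sum.∑-distrib-+ element (λ _ → 1#) ⟨
    +-Sum.sum (λ i → element i ⊕ 1#)             ≈⟨ +-Sum.sum-cong-≋ {q} (λ i → element-index (element i ⊕ 1#)) ⟨
    +-Sum.sum (λ i → element (index (element i ⊕ 1#))) ≈⟨ +-Sum.sum-permute element π ⟨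
    +-Sum.sum element                            ≈⟨ +-identityʳ _ ⟨
    +-Sum.sum element ⊕ 0#                       ∎)
    where
    shift : ∀ {a b} → a ⊕ b ≈ 0# → ∀ x → (x ⊕ a) ⊕ b ≈ x
    shift a+b≈0 x = ≈-trans (+-assoc x _ _) (≈-trans (+-congˡ a+b≈0) (+-identityʳ x))
    π : Permutation′ q
    π = inducedPermutation (_⊕ 1#) (_⊕ ⊖ 1#) +-congʳ +-congʳ
          (shift (-‿inverseˡ 1#)) (shift (-‿inverseʳ 1#))

  -- `(p ^ m) ×ᶠ 1#` is a power of `p ×ᶠ 1#`, and there are no zero divisors. Together with `q×1≈0`
  -- this shows that the characteristic is p.
  p^m×1≈0⇒p×1≈0 : ∀ p m → (p ^ m) ×ᶠ 1# ≈ 0# → p ×ᶠ 1# ≈ 0#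
  p^m×1≈0⇒p×1≈0 p zero    1≈0 = contradiction (≈-trans (≈-sym (+-identityʳ 1#)) 1≈0) 1≉0
  p^m×1≈0⇒p×1≈0 p (suc m) pp^m≈0 =
    [ id , p^m×1≈0⇒p×1≈0 p m ]′ (xy≈0⇒x≈0⊎y≈0 _ _ (≈-trans (≈-sym (×1-homo-* p (p ^ m))) pp^m≈0))

  #-roots-≤ : ∀ {n f} → Monic n f → #[ (λ x → f x ≟ᶠ 0#) ] ≤ n
  #-roots-≤ (unit f≈1) = ℕ.≤-reflexive (#-none _ λ x fx≈0 → 1≉0 (≈-trans (≈-sym (f≈1 x)) fx≈0))
  #-roots-≤ {suc n} {f} f-monic with ∃-dec (λ x → f x ≟ᶠ 0#) (λ x≈y fx≈0 → ≈-trans (Monic-cong f-monic (≈-sym x≈y)) fx≈0)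
  ... | no ¬root = subst (_≤ suc n) (sym (#-none _ λ x fx≈0 → ¬root (x , fx≈0))) z≤n
  ... | yes (a , fa≈0) with Monic-divide f-monic a
  ...   | g , g-monic , division = ℕ.≤-trans
      (#-⊎-≤ (λ x → f x ≟ᶠ 0#) (_≟ᶠ a) (λ x → g x ≟ᶠ 0#) split)
      (ℕ.+-mono-≤ (ℕ.≤-reflexive (#-≈ a)) (#-roots-≤ g-monic))
    where
    split : ∀ x → f x ≈ 0# → x ≈ a ⊎ g x ≈ 0#
    split x fx≈0 with g x ≟ᶠ 0#
    ... | yes gx≈0 = inj₂ gx≈0
    ... | no gx≉0 = inj₁ (⊗-cancelˡ gx≉0 (begin
      g x ⊗ x          ≈⟨ *-comm _ _ ⟩
      x ⊗ g x          ≈⟨ +-identityˡ _ ⟨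
      0# ⊕ x ⊗ g x     ≈⟨ +-congʳ fa≈0 ⟨
      f a ⊕ x ⊗ g x    ≈⟨ division x ⟨
      f x ⊕ a ⊗ g x    ≈⟨ +-congʳ fx≈0 ⟩
      0# ⊕ a ⊗ g x     ≈⟨ +-identityˡ _ ⟩
      a ⊗ g x          ≈⟨ *-comm _ _ ⟩
      g x ⊗ a          ∎))

  -- Roots of unity and fixed points of Frobenius powers

  _^_≟1 : ∀ x k → Dec (x ^ᶠ k ≈ 1#)
  x ^ k ≟1 = x ^ᶠ k ≟ᶠ 1#

  #-roots-of-unity-≤ : ∀ k → .{{NonZero k}} → #[ _^ k ≟1 ] ≤ k
  #-roots-of-unity-≤ k@(suc k-1) = subst (_≤ k)
    (#-cong (λ x → ⊖ 1# ⊕ x ^ᶠ k ≟ᶠ 0#) (_^ k ≟1)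
      (λ x eq → +-cancelˡ (⊖ 1#) _ _ (≈-trans eq (≈-sym (-‿inverseˡ 1#))))
      (λ x eq → ≈-trans (+-congˡ eq) (-‿inverseˡ 1#)))
    (#-roots-≤ (Monic-+ (⊖ 1#) (^-monic k-1)))
    where
    ^-monic : ∀ n → Monic (suc n) (_^ᶠ suc n)
    ^-monic zero    = step 0# (unit {_^ᶠ 0} λ _ → ≈-refl) (λ _ → ≈-sym (+-identityˡ _))
    ^-monic (suc n) = step 0# (^-monic n) (λ _ → ≈-sym (+-identityˡ _))

  -- The geometric sum (x^(q-1) - 1) / (x^k - 1) has at most q - 1 - k roots.
  #-roots-of-unity : ∀ {k} → .{{NonZero k}} → k ∣ q ∸ 1 → #[ _^ k ≟1 ] ≡ k
  #-roots-of-unity {k} (divides zero q-1≡0) = contradiction q-1≡0 (≢-nonZero⁻¹ (q ∸ 1))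
  #-roots-of-unity {k} (divides (suc j) q-1≡) = ℕ.≤-antisym (#-roots-of-unity-≤ k)
    (ℕ.+-cancelʳ-≤ (j * k) _ _ (subst (_≤ #[ _^ k ≟1 ] + j * k) (trans #≉0 q-1≡)
      (ℕ.≤-trans (#-⊎-≤ ≉0? (_^ k ≟1) (λ x → geometric k j x ≟ᶠ 0#) split)
                 (ℕ.+-monoʳ-≤ _ (#-roots-≤ (geometric-monic k j))))))
    where
    split : ∀ x → x ≉ 0# → x ^ᶠ k ≈ 1# ⊎ geometric k j x ≈ 0#
    split x x≉0 with geometric k j x ≟ᶠ 0#
    ... | yes G≈0 = inj₂ G≈0
    ... | no G≉0 = inj₁ (≈-sym (⊗-cancelˡ G≉0 (begin
      G ⊗ 1#     ≈⟨ *-identityʳ G ⟩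
      G          ≈⟨ +-cancelˡ 1# _ _ (≈-trans (+-congʳ (≈-sym x^[q-1]≈1)) (geometric-sum k j x)) ⟩
      x ^ᶠ k ⊗ G ≈⟨ *-comm _ _ ⟩
      G ⊗ x ^ᶠ k ∎)))
      where
      G = geometric k j x
      x^[q-1]≈1 : x ^ᶠ (suc j * k) ≈ 1#
      x^[q-1]≈1 = subst (λ n → x ^ᶠ n ≈ 1#) q-1≡ (fermat x≉0)

  -- Bézout's identity d = a l - b k with the negative term moved across: the factor x^(b k) = 1
  -- supplies the missing exponent.
  ^-cancel-≈1 : ∀ {x d k l} a b → x ^ᶠ k ≈ 1# → x ^ᶠ l ≈ 1# → d + b * k ≡ a * l → x ^ᶠ d ≈ 1#
  ^-cancel-≈1 {x} {d} {k} {l} a b x^k≈1 x^l≈1 eq = begin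
    x ^ᶠ d                ≈⟨ *-identityʳ _ ⟨
    x ^ᶠ d ⊗ 1#           ≈⟨ *-congˡ (^-∣-≈1 (n∣m*n b) x^k≈1) ⟨
    x ^ᶠ d ⊗ x ^ᶠ (b * k) ≈⟨ ^-homo-* x d (b * k) ⟨
    x ^ᶠ (d + b * k)      ≡⟨ cong (x ^ᶠ_) eq ⟩
    x ^ᶠ (a * l)          ≈⟨ ^-∣-≈1 (n∣m*n a) x^l≈1 ⟩
    1#                    ∎

  ^-gcd-≈1 : ∀ {x} m n → x ^ᶠ m ≈ 1# → x ^ᶠ n ≈ 1# → x ^ᶠ gcd m n ≈ 1#
  ^-gcd-≈1 {x} m n x^m≈1 x^n≈1 with Bézout.identity (gcd-GCD m n)
  ... | Bézout.+- a b eq = ^-cancel-≈1 a b x^n≈1 x^m≈1 eq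
  ... | Bézout.-+ a b eq = ^-cancel-≈1 b a x^m≈1 x^n≈1 eq

  ^-p^*-≈ : ∀ p a b {x} → x ^ᶠ (p ^ b) ≈ x → x ^ᶠ (p ^ (a * b)) ≈ x
  ^-p^*-≈ p zero    b x^p^b≈x = *-identityʳ _
  ^-p^*-≈ p (suc a) b {x} x^p^b≈x = begin
    x ^ᶠ (p ^ (b + a * b))           ≡⟨ cong (x ^ᶠ_) (ℕ.^-distribˡ-+-* p b (a * b)) ⟩
    x ^ᶠ (p ^ b * p ^ (a * b))       ≈⟨ ^-assocʳ x (p ^ b) _ ⟨
    (x ^ᶠ (p ^ b)) ^ᶠ (p ^ (a * b))  ≈⟨ ^-congˡ (p ^ (a * b)) x^p^b≈x ⟩
    x ^ᶠ (p ^ (a * b))               ≈⟨ ^-p^*-≈ p a b x^p^b≈x ⟩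
    x                                ∎

  -- The same use of Bézout, now on exponents of p: replacing x by its equal x^(p^(b k)) raises the
  -- Frobenius exponent d to d + b k = a l.
  ^-p^-cancel-≈ : ∀ p {x d k l} a b → x ^ᶠ (p ^ k) ≈ x → x ^ᶠ (p ^ l) ≈ x →
                  d + b * k ≡ a * l → x ^ᶠ (p ^ d) ≈ x
  ^-p^-cancel-≈ p {x} {d} {k} {l} a b x^p^k≈x x^p^l≈x eq = begin
    x ^ᶠ (p ^ d)                     ≈⟨ ^-congˡ (p ^ d) (^-p^*-≈ p b k x^p^k≈x) ⟨
    (x ^ᶠ (p ^ (b * k))) ^ᶠ (p ^ d)  ≈⟨ ^-assocʳ x (p ^ (b * k)) (p ^ d) ⟩
    x ^ᶠ (p ^ (b * k) * p ^ d)       ≡⟨ cong (x ^ᶠ_) (trans (sym (ℕ.^-distribˡ-+-* p (b * k) d)) (cong (p ^_) (trans (ℕ.+-comm (b * k) d) eq))) ⟩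
    x ^ᶠ (p ^ (a * l))               ≈⟨ ^-p^*-≈ p a l x^p^l≈x ⟩
    x                                ∎

  -- The element-wise form of the fact that the fields of p^m and p^n elements intersect in the
  -- field of p^gcd(m,n) elements.
  ^-p^gcd-≈ : ∀ p m n {x} → x ^ᶠ (p ^ m) ≈ x → x ^ᶠ (p ^ n) ≈ x → x ^ᶠ (p ^ gcd m n) ≈ x
  ^-p^gcd-≈ p m n {x} x^p^m≈x x^p^n≈x with Bézout.identity (gcd-GCD m n)
  ... | Bézout.+- a b eq = ^-p^-cancel-≈ p a b x^p^n≈x x^p^m≈x eq
  ... | Bézout.-+ a b eq = ^-p^-cancel-≈ p b a x^p^m≈x x^p^n≈x eq

-- The fibres of Λ

module Fibres {c ℓ₁ ℓ₂} (p e m h : ℕ) (p-prime : Prime p)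
  .{{_ : NonZero e}} .{{_ : NonZero h}}
  (h∣N∸1 : h ∣ p ^ e ∸ 1) (F : FiniteField c ℓ₁ ℓ₂ (p ^ m)) where

  open FiniteFieldProperties F public
  open import Relation.Binary.Reasoning.Setoid setoid
  open import Algebra.Solver.Ring.NaturalCoefficients.Default commutativeSemiring

  N Q s A : ℕ
  N = p ^ e
  Q = p ^ m
  s = p ^ gcd e m
  A = (N ∸ 1) / h

  instance
    s∸1≢0 : NonZero (s ∸ 1)
    s∸1≢0 = p^gcd∸1-nonZero p-prime e m
    N∸1≢0 : NonZero (N ∸ 1)
    -- The bound for s applies to N by taking m = 0, since gcd(e, 0) = e.
    N∸1≢0 = subst (λ k → NonZero (p ^ k ∸ 1)) (gcd-identityʳ e) (p^gcd∸1-nonZero p-prime e 0)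

  A*h≡N∸1 : A * h ≡ N ∸ 1
  A*h≡N∸1 = m/n*n≡m h∣N∸1

  instance
    A≢0 : NonZero A
    A≢0 = ℕ.m*n≢0⇒m≢0 A {h} {{subst NonZero (sym A*h≡N∸1) N∸1≢0}}

  x⊗x^[N∸1]≈x^N : ∀ x → x ⊗ x ^ᶠ (N ∸ 1) ≈ x ^ᶠ N
  x⊗x^[N∸1]≈x^N x = reflexive (cong (x ^ᶠ_) (suc[n∸1]≡n N))

  ^N-distrib-+ : ∀ x y → (x ⊕ y) ^ᶠ N ≈ x ^ᶠ N ⊕ y ^ᶠ N
  ^N-distrib-+ = ^p^e-distrib-+ p-prime (p^m×1≈0⇒p×1≈0 p m q×1≈0) e

  [x^h]^A≈x^[N∸1] : ∀ x → (x ^ᶠ h) ^ᶠ A ≈ x ^ᶠ (N ∸ 1)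
  [x^h]^A≈x^[N∸1] x = ≈-trans (^-assocʳ x h A) (reflexive (cong (x ^ᶠ_) (trans (ℕ.*-comm h A) A*h≡N∸1)))

  -- Since h A = N - 1, multiplying u by an h-th power changes u^A by an (N-1)-th power. Both the
  -- description of the fibres and the count of pairs rest on this.
  [ux^h]^A≈u^Ax^[N∸1] : ∀ u x → (u ⊗ x ^ᶠ h) ^ᶠ A ≈ u ^ᶠ A ⊗ x ^ᶠ (N ∸ 1)
  [ux^h]^A≈u^Ax^[N∸1] u x = ≈-trans (^-distrib-* u (x ^ᶠ h) A) (*-congˡ ([x^h]^A≈x^[N∸1] x))

  y : Carrier → Carrier
  y u = u ^ᶠ A -ᶠ 1#

  y+1≈u^A : ∀ u → y u ⊕ 1# ≈ u ^ᶠ A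
  y+1≈u^A u = ≈-trans (+-assoc _ _ _) (≈-trans (+-congˡ (-‿inverseˡ 1#)) (+-identityʳ _))

  y≈0⇒u^A≈1 : ∀ {u} → y u ≈ 0# → u ^ᶠ A ≈ 1#
  y≈0⇒u^A≈1 {u} y≈0 = ≈-trans (≈-sym (y+1≈u^A u)) (≈-trans (+-congʳ y≈0) (+-identityˡ 1#))

  u^A≈1⇒y≈0 : ∀ {u} → u ^ᶠ A ≈ 1# → y u ≈ 0#
  u^A≈1⇒y≈0 u^A≈1 = ≈-trans (+-congʳ u^A≈1) (-‿inverseʳ 1#)

  Λ-cong : Λ N h Preserves _≈_ ⟶ _≈_
  Λ-cong u≈v = *-cong u≈v (^-congˡ h (+-congʳ (^-congˡ A u≈v)))

  Λ≉0⇒u≉0 : ∀ {u} → Λ N h u ≉ 0# → u ≉ 0#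
  Λ≉0⇒u≉0 Λ≉0 u≈0 = Λ≉0 (≈-trans (*-congʳ u≈0) (zeroˡ _))

  Λ≉0⇒y≉0 : ∀ {u} → Λ N h u ≉ 0# → y u ≉ 0#
  Λ≉0⇒y≉0 Λ≉0 y≈0 = Λ≉0 (≈-trans (*-congˡ (≈-trans (^-congˡ h y≈0) (0^n≈0 h))) (zeroʳ _))

  Λ≉0⇒u^A≉1 : ∀ {u} → Λ N h u ≉ 0# → u ^ᶠ A ≉ 1#
  Λ≉0⇒u^A≉1 Λ≉0 = Λ≉0⇒y≉0 Λ≉0 ∘ u^A≈1⇒y≈0

  u≉0∧u^A≉1⇒Λ≉0 : ∀ {u} → u ≉ 0# → u ^ᶠ A ≉ 1# → Λ N h u ≉ 0#
  u≉0∧u^A≉1⇒Λ≉0 u≉0 u^A≉1 = ⊗-≉0 u≉0 (^-≉0 h (u^A≉1 ∘ y≈0⇒u^A≈1))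

  -- The fibre of Λ through u is the set of u (1 + z)^h with u^A z^N = z: for u' in the
  -- fibre, 1 + z is the ratio of the values of U^A - 1 at u and u'.
  module _ {u} (Λu≉0 : Λ N h u ≉ 0#) where

    private
      a = u ^ᶠ A

      ratio toKernel fromKernel : Carrier → Carrier
      ratio v = y u ⊗ y v ⁻¹
      toKernel v = ratio v -ᶠ 1#
      fromKernel z = u ⊗ (1# ⊕ z) ^ᶠ h

      1+toKernel : ∀ v → 1# ⊕ toKernel v ≈ ratio v
      1+toKernel v = ≈-trans (+-comm _ _) (≈-trans (+-assoc _ _ _) (≈-trans (+-congˡ (-‿inverseˡ 1#)) (+-identityʳ _)))

      [1+z]^N : ∀ z → (1# ⊕ z) ^ᶠ N ≈ 1# ⊕ z ^ᶠ N
      [1+z]^N z = ≈-trans (^N-distrib-+ 1# z) (+-congʳ (1^n≈1 N))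

      a[1+z]^N : ∀ z → a ⊗ (1# ⊕ z) ^ᶠ N ≈ a ⊕ a ⊗ z ^ᶠ N
      a[1+z]^N z = ≈-trans (*-congˡ ([1+z]^N z)) (≈-trans (distribˡ _ _ _) (+-congʳ (*-identityʳ a)))

      -- The additional factor w raises the exponent N - 1 to N, where the power map is additive.
      w⊗[uw^h]^A : ∀ w → w ⊗ (u ⊗ w ^ᶠ h) ^ᶠ A ≈ a ⊗ w ^ᶠ N
      w⊗[uw^h]^A w = begin
        w ⊗ (u ⊗ w ^ᶠ h) ^ᶠ A    ≈⟨ *-congˡ ([ux^h]^A≈u^Ax^[N∸1] u w) ⟩
        w ⊗ (a ⊗ w ^ᶠ (N ∸ 1))   ≈⟨ solve 3 (λ w a x → w :* (a :* x) := a :* (w :* x)) ≈-refl w a (w ^ᶠ (N ∸ 1)) ⟩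
        a ⊗ (w ⊗ w ^ᶠ (N ∸ 1))   ≈⟨ *-congˡ (x⊗x^[N∸1]≈x^N w) ⟩
        a ⊗ w ^ᶠ N               ∎

      module _ {v} (Λv≈Λu : Λ N h v ≈ Λ N h u) where

        yv≉0 : y v ≉ 0#
        yv≉0 = Λ≉0⇒y≉0 λ Λv≈0 → Λu≉0 (≈-trans (≈-sym Λv≈Λu) Λv≈0)

        ratio⊗yv : ratio v ⊗ y v ≈ y u
        ratio⊗yv = ≈-trans (*-assoc _ _ _)
          (≈-trans (*-congˡ (≈-trans (*-comm _ _) (⁻¹-inverseʳ yv≉0))) (*-identityʳ _))

        u⊗ratio^h≈v : u ⊗ ratio v ^ᶠ h ≈ v
        u⊗ratio^h≈v = ⊗-cancelˡ (^-≉0 h yv≉0) (begin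
          y v ^ᶠ h ⊗ (u ⊗ ratio v ^ᶠ h)  ≈⟨ solve 3 (λ y u r → y :* (u :* r) := u :* (r :* y)) ≈-refl (y v ^ᶠ h) u (ratio v ^ᶠ h) ⟩
          u ⊗ (ratio v ^ᶠ h ⊗ y v ^ᶠ h)  ≈⟨ *-congˡ (^-distrib-* (ratio v) (y v) h) ⟨
          u ⊗ (ratio v ⊗ y v) ^ᶠ h       ≈⟨ *-congˡ (^-congˡ h ratio⊗yv) ⟩
          u ⊗ y u ^ᶠ h                   ≈⟨ Λv≈Λu ⟨
          v ⊗ y v ^ᶠ h                   ≈⟨ *-comm _ _ ⟩
          y v ^ᶠ h ⊗ v                   ∎)

        -- Two evaluations of w v^A + 1 are compared: by additivity of the N-th power it is a + a
        -- z^N + 1, and by w y(v) = y(u) it is a + 1 + z.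
        toKernel-kernel : a ⊗ toKernel v ^ᶠ N ≈ toKernel v
        toKernel-kernel = +-cancelˡ (a ⊕ 1#) _ _ (begin
          a ⊕ 1# ⊕ a ⊗ z ^ᶠ N     ≈⟨ solve 2 (λ a b → a :+ con 1 :+ b := a :+ b :+ con 1) ≈-refl a (a ⊗ z ^ᶠ N) ⟩
          a ⊕ a ⊗ z ^ᶠ N ⊕ 1#     ≈⟨ +-congʳ (a[1+z]^N z) ⟨
          a ⊗ (1# ⊕ z) ^ᶠ N ⊕ 1#  ≈⟨ +-congʳ (*-congˡ (^-congˡ N (1+toKernel v))) ⟩
          a ⊗ w ^ᶠ N ⊕ 1#         ≈⟨ +-congʳ (w⊗[uw^h]^A w) ⟨
          w ⊗ (u ⊗ w ^ᶠ h) ^ᶠ A ⊕ 1# ≈⟨ +-congʳ (*-congˡ (^-congˡ A u⊗ratio^h≈v)) ⟩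
          w ⊗ v ^ᶠ A ⊕ 1#         ≈⟨ +-congʳ (*-congˡ (y+1≈u^A v)) ⟨
          w ⊗ (y v ⊕ 1#) ⊕ 1#     ≈⟨ solve 2 (λ w y → w :* (y :+ con 1) :+ con 1 := w :* y :+ con 1 :+ w) ≈-refl w (y v) ⟩
          w ⊗ y v ⊕ 1# ⊕ w        ≈⟨ +-congʳ (+-congʳ ratio⊗yv) ⟩
          y u ⊕ 1# ⊕ w            ≈⟨ +-cong (y+1≈u^A u) (≈-sym (1+toKernel v)) ⟩
          a ⊕ (1# ⊕ z)            ≈⟨ +-assoc _ _ _ ⟨
          a ⊕ 1# ⊕ z              ∎)
          where
          z = toKernel v
          w = ratio v

      module _ {z} (az^N≈z : a ⊗ z ^ᶠ N ≈ z) where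

        private
          w = 1# ⊕ z
          v = fromKernel z

        w⊗v^A : w ⊗ v ^ᶠ A ≈ a ⊕ z
        w⊗v^A = ≈-trans (w⊗[uw^h]^A w) (≈-trans (a[1+z]^N z) (+-congˡ az^N≈z))

        -- The identity recovers w as the ratio y(u) / y(v). It also shows w ≠ 0, because y(u) is
        -- nonzero.
        w⊗yv : w ⊗ y v ≈ y u
        w⊗yv = +-cancelʳ w _ _ (begin
          w ⊗ y v ⊕ w        ≈⟨ +-congˡ (*-identityʳ w) ⟨
          w ⊗ y v ⊕ w ⊗ 1#   ≈⟨ distribˡ _ _ _ ⟨
          w ⊗ (y v ⊕ 1#)     ≈⟨ *-congˡ (y+1≈u^A v) ⟩
          w ⊗ v ^ᶠ A         ≈⟨ w⊗v^A ⟩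
          a ⊕ z              ≈⟨ +-congʳ (y+1≈u^A u) ⟨
          y u ⊕ 1# ⊕ z       ≈⟨ +-assoc _ _ _ ⟩
          y u ⊕ w            ∎)

        fromKernel-fibre : Λ N h v ≈ Λ N h u
        fromKernel-fibre = begin
          u ⊗ w ^ᶠ h ⊗ y v ^ᶠ h    ≈⟨ *-assoc _ _ _ ⟩
          u ⊗ (w ^ᶠ h ⊗ y v ^ᶠ h)  ≈⟨ *-congˡ (^-distrib-* w (y v) h) ⟨
          u ⊗ (w ⊗ y v) ^ᶠ h       ≈⟨ *-congˡ (^-congˡ h w⊗yv) ⟩
          u ⊗ y u ^ᶠ h             ∎

        toKernel-fromKernel : toKernel v ≈ z
        toKernel-fromKernel = +-cancelˡ 1# _ _ (begin
          1# ⊕ toKernel v     ≈⟨ 1+toKernel v ⟩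
          y u ⊗ y v ⁻¹        ≈⟨ *-congʳ w⊗yv ⟨
          w ⊗ y v ⊗ y v ⁻¹    ≈⟨ *-assoc _ _ _ ⟩
          w ⊗ (y v ⊗ y v ⁻¹)  ≈⟨ *-congˡ (⁻¹-inverseʳ (yv≉0 fromKernel-fibre)) ⟩
          w ⊗ 1#              ≈⟨ *-identityʳ w ⟩
          w                   ∎)

    r-Λ≡#kernel : r N h (Λ N h u) ≡ #[ (λ z → a ⊗ z ^ᶠ N ≟ᶠ z) ]
    r-Λ≡#kernel = #-bijection (λ v → Λ N h v ≟ᶠ Λ N h u) (λ z → a ⊗ z ^ᶠ N ≟ᶠ z)
      toKernel fromKernel
      (λ v≈v′ → +-congʳ (*-congˡ (⁻¹-cong (+-congʳ (^-congˡ A v≈v′)))))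
      (λ z≈z′ → *-congˡ (^-congˡ h (+-congˡ z≈z′)))
      (λ v≈v′ eq → ≈-trans (Λ-cong (≈-sym v≈v′)) eq)
      (λ z≈z′ eq → ≈-trans (*-congˡ (^-congˡ N (≈-sym z≈z′))) (≈-trans eq z≈z′))
      (λ _ → toKernel-kernel)
      (λ _ → fromKernel-fibre)
      (λ v Λv≈Λu → ≈-trans (*-congˡ (^-congˡ h (1+toKernel v))) (u⊗ratio^h≈v Λv≈Λu))
      (λ _ → toKernel-fromKernel)

  -- Solutions z of u^A z^(N-1) = 1

  solves? : ∀ u → Decidable (λ z → u ^ᶠ A ⊗ z ^ᶠ (N ∸ 1) ≈ 1#)
  solves? u z = u ^ᶠ A ⊗ z ^ᶠ (N ∸ 1) ≟ᶠ 1#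

  #solutions : Carrier → ℕ
  #solutions u = #[ solves? u ]

  solves-resp : ∀ u {z w} → z ≈ w → u ^ᶠ A ⊗ z ^ᶠ (N ∸ 1) ≈ 1# → u ^ᶠ A ⊗ w ^ᶠ (N ∸ 1) ≈ 1#
  solves-resp u z≈w eq = ≈-trans (*-congˡ (^-congˡ (N ∸ 1) (≈-sym z≈w))) eq

  solution≉0 : ∀ {u z} → u ^ᶠ A ⊗ z ^ᶠ (N ∸ 1) ≈ 1# → z ≉ 0#
  solution≉0 {u} {z} eq z≈0 = 1≉0 (begin
    1#                       ≈⟨ eq ⟨
    u ^ᶠ A ⊗ z ^ᶠ (N ∸ 1)    ≈⟨ *-congˡ (≈-trans (^-congˡ (N ∸ 1) z≈0) (0^n≈0 (N ∸ 1))) ⟩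
    u ^ᶠ A ⊗ 0#              ≈⟨ zeroʳ _ ⟩
    0#                       ∎)

  -- The summand 1 is z = 0, which stands for u itself; for nonzero z the kernel equation can be
  -- divided by z.
  r-Λ≡1+#solutions : ∀ {u} → Λ N h u ≉ 0# → r N h (Λ N h u) ≡ 1 + #solutions u
  r-Λ≡1+#solutions {u} Λu≉0 = trans (r-Λ≡#kernel Λu≉0) (trans
    (#-⊎ (λ z → a ⊗ z ^ᶠ N ≟ᶠ z) (_≟ᶠ 0#) (solves? u) split zero-kernel nonzero-kernel
      (λ z z≈0 eq → solution≉0 eq z≈0))
    (cong (_+ #solutions u) (#-≈ 0#)))
    where
    a = u ^ᶠ A
    az^N : ∀ z → z ⊗ (a ⊗ z ^ᶠ (N ∸ 1)) ≈ a ⊗ z ^ᶠ N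
    az^N z = ≈-trans
      (solve 3 (λ z a x → z :* (a :* x) := a :* (z :* x)) ≈-refl z a (z ^ᶠ (N ∸ 1)))
      (*-congˡ (x⊗x^[N∸1]≈x^N z))
    split : ∀ z → a ⊗ z ^ᶠ N ≈ z → z ≈ 0# ⊎ a ⊗ z ^ᶠ (N ∸ 1) ≈ 1#
    split z eq with z ≟ᶠ 0#
    ... | yes z≈0 = inj₁ z≈0
    ... | no z≉0  = inj₂ (⊗-cancelˡ z≉0 (≈-trans (az^N z) (≈-trans eq (≈-sym (*-identityʳ z)))))
    zero-kernel : ∀ z → z ≈ 0# → a ⊗ z ^ᶠ N ≈ z
    zero-kernel z z≈0 = ≈-trans (≈-sym (az^N z)) (≈-trans (*-congʳ z≈0) (≈-trans (zeroˡ _) (≈-sym z≈0)))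
    nonzero-kernel : ∀ z → a ⊗ z ^ᶠ (N ∸ 1) ≈ 1# → a ⊗ z ^ᶠ N ≈ z
    nonzero-kernel z eq = ≈-trans (≈-sym (az^N z)) (≈-trans (*-congˡ eq) (*-identityʳ z))

  s∸1∣N∸1 : s ∸ 1 ∣ N ∸ 1
  s∸1∣N∸1 = p^gcd∸1∣p^e∸1 p-prime e m

  s∸1∣Q∸1 : s ∸ 1 ∣ Q ∸ 1
  s∸1∣Q∸1 = subst (λ g → p ^ g ∸ 1 ∣ Q ∸ 1) (gcd-comm m e) (p^gcd∸1∣p^e∸1 p-prime m e)

  -- Such an x is fixed by the e-th Frobenius power, and by the m-th as an element of the field,
  -- hence by the gcd(e,m)-th: x^s = x.
  x^[N∸1]≈1⇒x^[s∸1]≈1 : ∀ {x} → x ^ᶠ (N ∸ 1) ≈ 1# → x ^ᶠ (s ∸ 1) ≈ 1#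
  -- That x is nonzero is read off from its being a solution for u = 1.
  x^[N∸1]≈1⇒x^[s∸1]≈1 {x} eq = ⊗-cancelˡ (solution≉0 {1#} (≈-trans (*-congʳ (1^n≈1 A)) (≈-trans (*-identityˡ _) eq))) (begin
    x ^ᶠ suc (s ∸ 1) ≡⟨ cong (x ^ᶠ_) (suc[n∸1]≡n s) ⟩
    x ^ᶠ s           ≈⟨ ^-p^gcd-≈ p e m x^N≈x (x^q≈x x) ⟩
    x                ≈⟨ *-identityʳ x ⟨
    x ⊗ 1#           ∎)
    where
    x^N≈x : x ^ᶠ N ≈ x
    x^N≈x = ≈-trans (≈-sym (x⊗x^[N∸1]≈x^N x)) (≈-trans (*-congˡ eq) (*-identityʳ x))

  #x^[N∸1]≈1 : #[ _^ (N ∸ 1) ≟1 ] ≡ s ∸ 1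
  #x^[N∸1]≈1 = trans
    (#-cong (_^ (N ∸ 1) ≟1) (_^ (s ∸ 1) ≟1) (λ _ → x^[N∸1]≈1⇒x^[s∸1]≈1) (λ _ → ^-∣-≈1 s∸1∣N∸1))
    (#-roots-of-unity s∸1∣Q∸1)

  -- A divides N - 1, so u^A = 1 forces u^(s-1) = 1 as well. The resulting exponent gcd(A, s - 1)
  -- divides Q - 1, so all of its roots of unity lie in the field.
  #u^A≈1 : #[ _^ A ≟1 ] ≡ gcd A (s ∸ 1)
  #u^A≈1 = trans
    (#-cong (_^ A ≟1) (_^ gcd A (s ∸ 1) ≟1)
      (λ u u^A≈1 → ^-gcd-≈1 A (s ∸ 1) u^A≈1
        (x^[N∸1]≈1⇒x^[s∸1]≈1 (^-∣-≈1 (divides h (trans (sym A*h≡N∸1) (ℕ.*-comm A h))) u^A≈1)))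
      (λ _ → ^-∣-≈1 (gcd[m,n]∣m A (s ∸ 1))))
    (#-roots-of-unity {{≢-nonZero λ gcd≡0 → ≢-nonZero⁻¹ A (gcd[m,n]≡0⇒m≡0 gcd≡0)}}
      (∣-trans (gcd[m,n]∣n A (s ∸ 1)) s∸1∣Q∸1))

  -- The solutions form a coset of the group of (N-1)-th roots of unity.
  solution⇒#solutions≡s∸1 : ∀ {u z} → u ^ᶠ A ⊗ z ^ᶠ (N ∸ 1) ≈ 1# → #solutions u ≡ s ∸ 1
  solution⇒#solutions≡s∸1 {u} {z₀} eq₀ = trans
    (#-bijection (solves? u) (_^ (N ∸ 1) ≟1) (_⊗ z₀ ⁻¹) (_⊗ z₀) *-congʳ *-congʳ
      (solves-resp u)
      (λ z≈w eq → ≈-trans (^-congˡ (N ∸ 1) (≈-sym z≈w)) eq)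
      (λ z eq → begin
        (z ⊗ z₀ ⁻¹) ^ᶠ (N ∸ 1)                                   ≈⟨ *-identityˡ _ ⟨
        1# ⊗ (z ⊗ z₀ ⁻¹) ^ᶠ (N ∸ 1)                              ≈⟨ *-congʳ eq₀ ⟨
        u ^ᶠ A ⊗ z₀ ^ᶠ (N ∸ 1) ⊗ (z ⊗ z₀ ⁻¹) ^ᶠ (N ∸ 1)          ≈⟨ *-assoc _ _ _ ⟩
        u ^ᶠ A ⊗ (z₀ ^ᶠ (N ∸ 1) ⊗ (z ⊗ z₀ ⁻¹) ^ᶠ (N ∸ 1))        ≈⟨ *-congˡ (^-distrib-* z₀ (z ⊗ z₀ ⁻¹) (N ∸ 1)) ⟨
        u ^ᶠ A ⊗ (z₀ ⊗ (z ⊗ z₀ ⁻¹)) ^ᶠ (N ∸ 1)                   ≈⟨ *-congˡ (^-congˡ (N ∸ 1) (≈-trans (*-comm _ _) (⊗⁻¹⊗ z))) ⟩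
        u ^ᶠ A ⊗ z ^ᶠ (N ∸ 1)                                    ≈⟨ eq ⟩
        1#                                                       ∎)
      (λ z z^≈1 → begin
        u ^ᶠ A ⊗ (z ⊗ z₀) ^ᶠ (N ∸ 1)                ≈⟨ *-congˡ (^-distrib-* z z₀ (N ∸ 1)) ⟩
        u ^ᶠ A ⊗ (z ^ᶠ (N ∸ 1) ⊗ z₀ ^ᶠ (N ∸ 1))     ≈⟨ *-congˡ (≈-trans (*-congʳ z^≈1) (*-identityˡ _)) ⟩
        u ^ᶠ A ⊗ z₀ ^ᶠ (N ∸ 1)                      ≈⟨ eq₀ ⟩
        1#                                          ∎)
      (λ z _ → ⊗⁻¹⊗ z)
      (λ z _ → ≈-trans (*-assoc _ _ _) (≈-trans (*-congˡ z₀⊗z₀⁻¹≈1) (*-identityʳ z))))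
    #x^[N∸1]≈1
    where
    z₀⊗z₀⁻¹≈1 : z₀ ⊗ z₀ ⁻¹ ≈ 1#
    z₀⊗z₀⁻¹≈1 = ⁻¹-inverseʳ (solution≉0 eq₀)
    ⊗⁻¹⊗ : ∀ z → z ⊗ z₀ ⁻¹ ⊗ z₀ ≈ z
    ⊗⁻¹⊗ z = ≈-trans (*-assoc _ _ _) (≈-trans (*-congˡ (≈-trans (*-comm _ _) z₀⊗z₀⁻¹≈1)) (*-identityʳ z))

  #solutions≡0⊎s∸1 : ∀ u → #solutions u ≡ 0 ⊎ #solutions u ≡ s ∸ 1
  #solutions≡0⊎s∸1 u with ∃-dec (solves? u) (solves-resp u)
  ... | yes (_ , eq) = inj₂ (solution⇒#solutions≡s∸1 eq)
  ... | no ¬∃        = inj₁ (#-none (solves? u) λ z eq → ¬∃ (z , eq))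

  u≈0⇒#solutions≡0 : ∀ {u} → u ≈ 0# → #solutions u ≡ 0
  u≈0⇒#solutions≡0 {u} u≈0 = #-none (solves? u) λ z eq → 1≉0 (≈-trans (≈-sym eq)
    (≈-trans (*-congʳ (≈-trans (^-congˡ A u≈0) (0^n≈0 A))) (zeroˡ _)))

  u^A≈1⇒#solutions≡s∸1 : ∀ {u} → u ^ᶠ A ≈ 1# → #solutions u ≡ s ∸ 1
  u^A≈1⇒#solutions≡s∸1 u^A≈1 = solution⇒#solutions≡s∸1 {z = 1#}
    (≈-trans (*-cong u^A≈1 (1^n≈1 (N ∸ 1))) (*-identityˡ 1#))

  0≢s∸1 : 0 ≢ s ∸ 1
  0≢s∸1 = ≢-nonZero⁻¹ (s ∸ 1) ∘ sym

  solvable? : Decidable (λ u → #solutions u ≡ s ∸ 1)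
  solvable? u = #solutions u ≟ s ∸ 1

  -- Count the pairs (u , z) with u^A z^(N-1) = (u z^h)^A = 1 in two ways.
  #solvable : (s ∸ 1) * #[ solvable? ] ≡ gcd A (s ∸ 1) * (Q ∸ 1)
  #solvable = trans (cong ((s ∸ 1) *_) (#≡∑ solvable?)) (trans
    (sym (∑-*ˡ (s ∸ 1) (indicator ∘ solvable?))) (trans
    (∑-cong by-u) (trans
    (∑-swap λ u z → indicator (solves? u z)) (trans
    (∑-cong by-z) (trans
    (∑-*ˡ (gcd A (s ∸ 1)) (indicator ∘ ≉0?))
    (cong (gcd A (s ∸ 1) *_) (trans (sym (#≡∑ ≉0?)) #≉0)))))))
    where
    by-u : ∀ u → (s ∸ 1) * indicator (solvable? u) ≡ ∑ (indicator ∘ solves? u)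
    by-u u = trans
      (*-indicator (solvable? u) id λ neq → [ id , (λ eq → contradiction eq neq) ]′ (#solutions≡0⊎s∸1 u))
      (#≡∑ (solves? u))
    by-z : ∀ z → ∑ (λ u → indicator (solves? u z)) ≡ gcd A (s ∸ 1) * indicator (≉0? z)
    by-z z = sym (trans
      (*-indicator (≉0? z) nonzero λ ¬z≉0 → #-none (λ u → solves? u z) λ u eq → ¬z≉0 (solution≉0 eq))
      (#≡∑ λ u → solves? u z))
      where
      cancel : ∀ {z w} → z ⊗ w ≈ 1# → ∀ u → u ⊗ z ^ᶠ h ⊗ w ^ᶠ h ≈ u
      cancel {z} {w} zw≈1 u = begin
        u ⊗ z ^ᶠ h ⊗ w ^ᶠ h    ≈⟨ *-assoc _ _ _ ⟩
        u ⊗ (z ^ᶠ h ⊗ w ^ᶠ h)  ≈⟨ *-congˡ (^-distrib-* z w h) ⟨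
        u ⊗ (z ⊗ w) ^ᶠ h       ≈⟨ *-congˡ (≈-trans (^-congˡ h zw≈1) (1^n≈1 h)) ⟩
        u ⊗ 1#                 ≈⟨ *-identityʳ u ⟩
        u                      ∎
      -- For fixed nonzero z, multiplication by z^h carries the u in question to the A-th roots of
      -- unity.
      nonzero : z ≉ 0# → #[ (λ u → solves? u z) ] ≡ gcd A (s ∸ 1)
      nonzero z≉0 = trans
        (#-bijection (λ u → solves? u z) (_^ A ≟1) (_⊗ z ^ᶠ h) (_⊗ (z ⁻¹) ^ᶠ h) *-congʳ *-congʳ
          (λ u≈v eq → ≈-trans (*-congʳ (^-congˡ A (≈-sym u≈v))) eq)
          (λ u≈v eq → ≈-trans (^-congˡ A (≈-sym u≈v)) eq)
          (λ u eq → ≈-trans ([ux^h]^A≈u^Ax^[N∸1] u z) eq)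
          (λ v v^A≈1 → ≈-trans (≈-sym ([ux^h]^A≈u^Ax^[N∸1] _ z))
            (≈-trans (^-congˡ A (cancel z⁻¹z≈1 v)) v^A≈1))
          (λ u _ → cancel zz⁻¹≈1 u)
          (λ v _ → cancel z⁻¹z≈1 v))
        #u^A≈1
        where
        zz⁻¹≈1 = ⁻¹-inverseʳ z≉0
        z⁻¹z≈1 = ≈-trans (*-comm _ _) zz⁻¹≈1

  -- Sizes of the fibres and relations between their numbers

  r-cong : ∀ {t t′} → t ≈ t′ → r N h t ≡ r N h t′
  r-cong {t} {t′} t≈t′ = #-cong (λ u → Λ N h u ≟ᶠ t) (λ u → Λ N h u ≟ᶠ t′)
    (λ _ eq → ≈-trans eq t≈t′) (λ _ eq → ≈-trans eq (≈-sym t≈t′))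

  fibre? : ∀ k → Decidable (λ t → t ≉ 0# × r N h t ≡ k)
  fibre? k t = ¬? (t ≟ᶠ 0#) ×-dec (r N h t ≟ k)

  #fibres : ℕ → ℕ
  #fibres k = #[ fibre? k ]

  *-#fibres : ∀ k → k * #fibres k ≡ #[ (λ u → fibre? k (Λ N h u)) ]
  *-#fibres k = *-#-fibres (fibre? k) (Λ N h) k
    (λ t≈t′ (t≉0 , rt≡k) → (λ t′≈0 → t≉0 (≈-trans t≈t′ t′≈0)) , trans (r-cong (≈-sym t≈t′)) rt≡k)
    (λ _ → proj₂)

  s≢1 : s ≢ 1
  s≢1 s≡1 = 0≢s∸1 (sym (cong (_∸ 1) s≡1))

  r-Λ≡s : ∀ {u} → Λ N h u ≉ 0# → #solutions u ≡ s ∸ 1 → r N h (Λ N h u) ≡ s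
  r-Λ≡s Λu≉0 eq = trans (r-Λ≡1+#solutions Λu≉0) (trans (cong suc eq) (suc[n∸1]≡n s))

  r-trichotomy : ∀ t → t ≉ 0# → r N h t ≡ 0 ⊎ r N h t ≡ 1 ⊎ r N h t ≡ s
  r-trichotomy t t≉0 with ∃-dec (λ u → Λ N h u ≟ᶠ t) (λ u≈v eq → ≈-trans (Λ-cong (≈-sym u≈v)) eq)
  ... | no ¬∃ = inj₁ (#-none (λ u → Λ N h u ≟ᶠ t) λ u eq → ¬∃ (u , eq))
  ... | yes (u , Λu≈t) with #solutions≡0⊎s∸1 u
  ...   | inj₁ eq = inj₂ (inj₁ (trans (r-cong (≈-sym Λu≈t)) (trans (r-Λ≡1+#solutions Λu≉0) (cong suc eq))))
    where Λu≉0 = λ Λu≈0 → t≉0 (≈-trans (≈-sym Λu≈t) Λu≈0)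
  ...   | inj₂ eq = inj₂ (inj₂ (trans (r-cong (≈-sym Λu≈t)) (r-Λ≡s Λu≉0 eq)))
    where Λu≉0 = λ Λu≈0 → t≉0 (≈-trans (≈-sym Λu≈t) Λu≈0)

  -- A u with solutions is nonzero, so either u^A = 1 or Λ(u) ≠ 0; in the second case it lies in a
  -- fibre of s points.
  #solvable≡s*#fibres+gcd : #[ solvable? ] ≡ s * #fibres s + gcd A (s ∸ 1)
  #solvable≡s*#fibres+gcd = trans
    (#-⊎ solvable? (λ u → fibre? s (Λ N h u)) (_^ A ≟1) split
      (λ u (Λu≉0 , r≡s) → cong (_∸ 1) (trans (sym (r-Λ≡1+#solutions Λu≉0)) r≡s))
      (λ _ → u^A≈1⇒#solutions≡s∸1)
      (λ u (Λu≉0 , _) → Λ≉0⇒u^A≉1 Λu≉0))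
    (cong₂ _+_ (sym (*-#fibres s)) #u^A≈1)
    where
    split : ∀ u → #solutions u ≡ s ∸ 1 → (Λ N h u ≉ 0# × r N h (Λ N h u) ≡ s) ⊎ u ^ᶠ A ≈ 1#
    split u eq with u ^ᶠ A ≟ᶠ 1#
    ... | yes u^A≈1 = inj₂ u^A≈1
    ... | no u^A≉1  = inj₁ (Λu≉0 , r-Λ≡s Λu≉0 eq)
      where
      Λu≉0 = u≉0∧u^A≉1⇒Λ≉0 (λ u≈0 → 0≢s∸1 (trans (sym (u≈0⇒#solutions≡0 u≈0)) eq)) u^A≉1

  -- A nonzero u without solutions has u^A ≠ 1, hence Λ(u) ≠ 0, and is alone in its fibre.
  Q∸1≡#fibres-1+#solvable : Q ∸ 1 ≡ #fibres 1 + #[ solvable? ]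
  Q∸1≡#fibres-1+#solvable = trans (sym #≉0) (trans
    (#-⊎ ≉0? (λ u → fibre? 1 (Λ N h u)) solvable? split
      (λ u (Λu≉0 , _) → Λ≉0⇒u≉0 Λu≉0)
      (λ u eq u≈0 → 0≢s∸1 (trans (sym (u≈0⇒#solutions≡0 u≈0)) eq))
      (λ u (Λu≉0 , r≡1) eq → s≢1 (trans (sym (r-Λ≡s Λu≉0 eq)) r≡1)))
    (cong (_+ #[ solvable? ]) (trans (sym (*-#fibres 1)) (ℕ.*-identityˡ (#fibres 1)))))
    where
    split : ∀ u → u ≉ 0# → (Λ N h u ≉ 0# × r N h (Λ N h u) ≡ 1) ⊎ #solutions u ≡ s ∸ 1
    split u u≉0 with #solutions≡0⊎s∸1 u
    ... | inj₂ eq = inj₂ eq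
    ... | inj₁ eq = inj₁ (Λu≉0 , trans (r-Λ≡1+#solutions Λu≉0) (cong suc eq))
      where
      Λu≉0 = u≉0∧u^A≉1⇒Λ≉0 u≉0 λ u^A≈1 → 0≢s∸1 (trans (sym eq) (u^A≈1⇒#solutions≡s∸1 u^A≈1))

  Q∸1≡#fibres : Q ∸ 1 ≡ #fibres 0 + (#fibres 1 + #fibres s)
  Q∸1≡#fibres = trans (sym #≉0) (trans
    (#-⊎ ≉0? (fibre? 0) nonempty? split₀ (λ _ → proj₁) (λ _ → proj₁)
      (λ t (_ , r≡0) (_ , r≢0) → r≢0 r≡0))
    (cong (λ n → #fibres 0 + n) (#-⊎ nonempty? (fibre? 1) (fibre? s) split₁
      (λ t (t≉0 , r≡1) → t≉0 , λ r≡0 → ℕ.0≢1+n (trans (sym r≡0) r≡1))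
      (λ t (t≉0 , r≡s) → t≉0 , λ r≡0 → 0≢s∸1 (cong (_∸ 1) (trans (sym r≡0) r≡s)))
      (λ t (_ , r≡1) (_ , r≡s) → s≢1 (trans (sym r≡s) r≡1)))))
    where
    nonempty? : Decidable (λ t → t ≉ 0# × r N h t ≢ 0)
    nonempty? t = ≉0? t ×-dec ¬? (r N h t ≟ 0)
    split₀ : ∀ t → t ≉ 0# → (t ≉ 0# × r N h t ≡ 0) ⊎ (t ≉ 0# × r N h t ≢ 0)
    split₀ t t≉0 with r N h t ≟ 0
    ... | yes r≡0 = inj₁ (t≉0 , r≡0)
    ... | no r≢0  = inj₂ (t≉0 , r≢0)
    split₁ : ∀ t → t ≉ 0# × r N h t ≢ 0 → (t ≉ 0# × r N h t ≡ 1) ⊎ (t ≉ 0# × r N h t ≡ s)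
    split₁ t (t≉0 , r≢0) with r-trichotomy t t≉0
    ... | inj₁ r≡0        = contradiction r≡0 r≢0
    ... | inj₂ (inj₁ r≡1) = inj₁ (t≉0 , r≡1)
    ... | inj₂ (inj₂ r≡s) = inj₂ (t≉0 , r≡s)

  r-0≡1+gcd : r N h 0# ≡ 1 + gcd A (s ∸ 1)
  r-0≡1+gcd = trans
    (#-⊎ (λ u → Λ N h u ≟ᶠ 0#) (_≟ᶠ 0#) (_^ A ≟1) split
      (λ u u≈0 → ≈-trans (*-congʳ u≈0) (zeroˡ _))
      (λ u u^A≈1 → ≈-trans (*-congˡ (≈-trans (^-congˡ h (u^A≈1⇒y≈0 u^A≈1)) (0^n≈0 h))) (zeroʳ _))
      (λ u u≈0 u^A≈1 → 1≉0 (≈-trans (≈-sym u^A≈1) (≈-trans (^-congˡ A u≈0) (0^n≈0 A)))))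
    (cong₂ _+_ (#-≈ 0#) #u^A≈1)
    where
    split : ∀ u → Λ N h u ≈ 0# → u ≈ 0# ⊎ u ^ᶠ A ≈ 1#
    split u Λu≈0 with u ≟ᶠ 0# | u ^ᶠ A ≟ᶠ 1#
    ... | yes u≈0 | _         = inj₁ u≈0
    ... | _       | yes u^A≈1 = inj₂ u^A≈1
    ... | no u≉0  | no u^A≉1  = contradiction Λu≈0 (u≉0∧u^A≉1⇒Λ≉0 u≉0 u^A≉1)

-- Solving for the numbers of fibres

-- Both sides are gcd(n, h σ), since h A = n = σ C.
gcd[A,σ]*h≡gcd[h,C]*σ : ∀ {n h A σ C} → A * h ≡ n → C * σ ≡ n → gcd A σ * h ≡ gcd h C * σ
gcd[A,σ]*h≡gcd[h,C]*σ {n} {h} {A} {σ} {C} Ah≡n Cσ≡n = begin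
  gcd A σ * h         ≡⟨ ℕ.*-comm (gcd A σ) h ⟩
  h * gcd A σ         ≡⟨ c*gcd[m,n]≡gcd[cm,cn] h A σ ⟩
  gcd (h * A) (h * σ) ≡⟨ cong₂ gcd (trans (ℕ.*-comm h A) (trans Ah≡n (trans (sym Cσ≡n) (ℕ.*-comm C σ)))) (ℕ.*-comm h σ) ⟩
  gcd (σ * C) (σ * h) ≡⟨ c*gcd[m,n]≡gcd[cm,cn] σ C h ⟨
  σ * gcd C h         ≡⟨ cong₂ _*_ {σ} refl (gcd-comm C h) ⟩
  σ * gcd h C         ≡⟨ ℕ.*-comm σ (gcd h C) ⟩
  gcd h C * σ         ∎
  where open ≡-Reasoning

-- Here σ is s - 1, d is gcd(A, s - 1) and M is the number of u with solutions. The letter `Q`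
-- stands for the number Q - 1 of nonzero elements, so the field has `suc Q` elements.
module FibreCounts (σ κ h d M Q f₀ f₁ fₛ : ℕ) .{{_ : NonZero σ}} (dh≡κσ : d * h ≡ κ * σ)
         (σM≡dQ : σ * M ≡ d * Q) (M≡sfₛ+d : M ≡ suc σ * fₛ + d)
         (Q≡f₁+M : Q ≡ f₁ + M) (Q≡f₀+f₁+fₛ : Q ≡ f₀ + (f₁ + fₛ)) where

  open ≡-Reasoning
  open +-*-Solver

  M*h≡κ*Q : M * h ≡ κ * Q
  M*h≡κ*Q = ℕ.*-cancelˡ-≡ (M * h) (κ * Q) σ (begin
    σ * (M * h)  ≡⟨ ℕ.*-assoc σ M h ⟨
    σ * M * h    ≡⟨ cong (_* h) σM≡dQ ⟩
    d * Q * h    ≡⟨ solve 3 (λ d Q h → d :* Q :* h := d :* h :* Q) refl d Q h ⟩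
    d * h * Q    ≡⟨ cong (_* Q) dh≡κσ ⟩
    κ * σ * Q    ≡⟨ solve 3 (λ κ σ Q → κ :* σ :* Q := σ :* (κ :* Q)) refl κ σ Q ⟩
    σ * (κ * Q)  ∎)

  fₛ*[h*s] : fₛ * (h * suc σ) ≡ κ * (Q ∸ σ)
  fₛ*[h*s] = begin
    fₛ * (h * suc σ)                  ≡⟨ ℕ.m+n∸n≡m _ (d * h) ⟨
    fₛ * (h * suc σ) + d * h ∸ d * h
      ≡⟨ cong₂ _∸_ (solve 4 (λ f h s d → f :* (h :* s) :+ d :* h := (s :* f :+ d) :* h) refl fₛ h (suc σ) d) dh≡κσ ⟩
    (suc σ * fₛ + d) * h ∸ κ * σ      ≡⟨ cong (λ x → x * h ∸ κ * σ) M≡sfₛ+d ⟨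
    M * h ∸ κ * σ                     ≡⟨ cong (_∸ κ * σ) M*h≡κ*Q ⟩
    κ * Q ∸ κ * σ                     ≡⟨ ℕ.*-distribˡ-∸ κ Q σ ⟨
    κ * (Q ∸ σ)                       ∎

  -- Subtracting M h = κ Q from (f₁ + M) h leaves the fibres of one point. Adding M h before
  -- removing it keeps the truncated subtraction exact.
  f₁*h : f₁ * h ≡ (h ∸ κ) * Q
  f₁*h = begin
    f₁ * h                  ≡⟨ ℕ.m+n∸n≡m (f₁ * h) (M * h) ⟨
    f₁ * h + M * h ∸ M * h  ≡⟨ cong (_∸ M * h) (ℕ.*-distribʳ-+ h f₁ M) ⟨
    (f₁ + M) * h ∸ M * h    ≡⟨ cong₂ (λ x y → x * h ∸ y) (sym Q≡f₁+M) M*h≡κ*Q ⟩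
    Q * h ∸ κ * Q           ≡⟨ cong (_∸ κ * Q) (ℕ.*-comm Q h) ⟩
    h * Q ∸ κ * Q           ≡⟨ ℕ.*-distribʳ-∸ Q h κ ⟨
    (h ∸ κ) * Q             ∎

  -- Source and target have equal size, so the missed targets balance the excess points: σ in each
  -- fibre of s points and d in the zero fibre.
  f₀≡σfₛ+d : f₀ ≡ σ * fₛ + d
  f₀≡σfₛ+d = ℕ.+-cancelʳ-≡ (f₁ + fₛ) f₀ (σ * fₛ + d) (begin
    f₀ + (f₁ + fₛ)          ≡⟨ Q≡f₀+f₁+fₛ ⟨
    Q                       ≡⟨ Q≡f₁+M ⟩
    f₁ + M                  ≡⟨ cong (λ x → f₁ + x) M≡sfₛ+d ⟩
    f₁ + (suc σ * fₛ + d)   ≡⟨ solve 4 (λ f₁ σ fₛ d → f₁ :+ ((con 1 :+ σ) :* fₛ :+ d) := σ :* fₛ :+ d :+ (f₁ :+ fₛ)) refl f₁ σ fₛ d ⟩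
    σ * fₛ + d + (f₁ + fₛ)  ∎)

  f₀*[h*s] : f₀ * (h * suc σ) ≡ κ * σ * suc Q
  f₀*[h*s] = begin
    f₀ * (h * suc σ)
      ≡⟨ cong (_* (h * suc σ)) f₀≡σfₛ+d ⟩
    (σ * fₛ + d) * (h * suc σ)
      ≡⟨ solve 4 (λ σ fₛ d h → (σ :* fₛ :+ d) :* (h :* (con 1 :+ σ)) := σ :* (((con 1 :+ σ) :* fₛ :+ d) :* h) :+ d :* h) refl σ fₛ d h ⟩
    σ * ((suc σ * fₛ + d) * h) + d * h
      ≡⟨ cong₂ (λ x y → σ * (x * h) + y) (sym M≡sfₛ+d) dh≡κσ ⟩
    σ * (M * h) + κ * σ
      ≡⟨ cong (λ x → σ * x + κ * σ) M*h≡κ*Q ⟩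
    σ * (κ * Q) + κ * σ
      ≡⟨ solve 3 (λ σ κ Q → σ :* (κ :* Q) :+ κ :* σ := κ :* σ :* (con 1 :+ Q)) refl σ κ Q ⟩
    κ * σ * suc Q ∎

-- From natural numbers to fractions

/1≡/ : ∀ a b n .{{_ : NonZero n}} → a * n ≡ b → + a ℚ./ 1 ≡ + b ℚ./ n
/1≡/ a b n@(suc n-1) an≡b = ℚ.fromℚᵘ-cong {mkℚᵘ (+ a) 0} {mkℚᵘ (+ b) n-1} (*≡* (begin
  + a ℤ.* + n   ≡⟨ ℤ.pos-* a n ⟨
  + (a * n)     ≡⟨ cong (λ x → + x) an≡b ⟩
  + b           ≡⟨ ℤ.*-identityʳ (+ b) ⟨
  + b ℤ.* + 1   ∎))
  where open ≡-Reasoning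

suc/1≡1+/ : ∀ a b n .{{_ : NonZero n}} → a * n ≡ b → + suc a ℚ./ 1 ≡ 1ℚ ℚ.+ (+ b ℚ./ n)
suc/1≡1+/ a b n an≡b = trans (ℚ.toℚᵘ-injective (begin
  ℚ.toℚᵘ (+ suc a ℚ./ 1)                  ≈⟨ ℚ.toℚᵘ-fromℚᵘ (mkℚᵘ (+ suc a) 0) ⟩
  mkℚᵘ (+ suc a) 0                        ≈⟨ *≡* (cong (ℤ._* + 1) (cong (λ x → + 1 ℤ.+ x) (sym (ℤ.*-identityʳ (+ a))))) ⟩
  ℚ.toℚᵘ 1ℚ ℚᵘ.+ mkℚᵘ (+ a) 0             ≈⟨ ℚᵘ.+-congʳ (ℚ.toℚᵘ 1ℚ) (ℚ.toℚᵘ-fromℚᵘ (mkℚᵘ (+ a) 0)) ⟨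
  ℚ.toℚᵘ 1ℚ ℚᵘ.+ ℚ.toℚᵘ (+ a ℚ./ 1)       ≈⟨ ℚ.toℚᵘ-homo-+ 1ℚ (+ a ℚ./ 1) ⟨
  ℚ.toℚᵘ (1ℚ ℚ.+ (+ a ℚ./ 1))             ∎)) (cong (1ℚ ℚ.+_) (/1≡/ a b n an≡b))
  where open import Relation.Binary.Reasoning.Setoid ℚᵘ.≃-setoid

theorem4p2 : ∀ {c ℓ₁ ℓ₂} (p e m h : ℕ) (p-prime : Prime p) →
  .{{_ : NonZero e}} .{{_ : NonZero m}} .{{_ : NonZero h}} →
  h ∣ p ^ e ∸ 1 →
  (F : FiniteField c ℓ₁ ℓ₂ (p ^ m)) →
  let open FiniteField F
      N = p ^ e
      Q = p ^ m
      s = p ^ gcd e m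
      instance
        p≢0 = prime⇒nonZero p-prime
        s≢0 = m^n≢0 p (gcd e m)
        s∸1≢0 = p^gcd∸1-nonZero p-prime e m
        h*s≢0 = m*n≢0 h s
      C = (N ∸ 1) / (s ∸ 1)
      κ = gcd h C
      -- the number of nonzero t whose fibre has exactly k points
      #fibres = λ k → #[ (λ t → ¬? (t ≟ᶠ 0#) ×-dec (r N h t ≟ k)) ]
  in
    (+ r N h 0# ℚ./ 1 ≡ 1ℚ ℚ.+ (+ (κ * (s ∸ 1)) ℚ./ h))
  × (∀ t → t ≉ 0# → (r N h t ≡ 0) ⊎ (r N h t ≡ 1) ⊎ (r N h t ≡ s))
  × (+ #fibres 0 ℚ./ 1 ≡ + (κ * (s ∸ 1) * Q) ℚ./ (h * s))
  × (+ #fibres 1 ℚ./ 1 ≡ + ((h ∸ κ) * (Q ∸ 1)) ℚ./ h)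
  × (+ #fibres s ℚ./ 1 ≡ + (κ * (Q ∸ s)) ℚ./ (h * s))
theorem4p2 p e m h p-prime h∣N∸1 F =
    trans (cong (λ x → + x ℚ./ 1) r-0≡1+gcd) (suc/1≡1+/ (gcd A (s ∸ 1)) (κ * (s ∸ 1)) h gcd*h≡κ*[s∸1])
  , r-trichotomy
  , /1≡/ (#fibres 0) (κ * (s ∸ 1) * Q) (h * s) {{h*s≢0}} f₀*h*s
  , /1≡/ (#fibres 1) ((h ∸ κ) * (Q ∸ 1)) h f₁*h
  , /1≡/ (#fibres s) (κ * (Q ∸ s)) (h * s) {{h*s≢0}} fₛ*h*s
  where
  open Fibres p e m h p-prime h∣N∸1 F
  C = (N ∸ 1) / (s ∸ 1)
  κ = gcd h C
  h*s≢0 : NonZero (h * s)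
  h*s≢0 = m*n≢0 h s {{it}} {{m^n≢0 p (gcd e m) {{prime⇒nonZero p-prime}}}}
  gcd*h≡κ*[s∸1] : gcd A (s ∸ 1) * h ≡ κ * (s ∸ 1)
  gcd*h≡κ*[s∸1] = gcd[A,σ]*h≡gcd[h,C]*σ {h = h} {A = A} A*h≡N∸1 (m/n*n≡m s∸1∣N∸1)
  #solvable≡ : #[ solvable? ] ≡ suc (s ∸ 1) * #fibres s + gcd A (s ∸ 1)
  #solvable≡ = trans #solvable≡s*#fibres+gcd (cong (λ x → x * #fibres s + gcd A (s ∸ 1)) (sym (suc[n∸1]≡n s)))
  open FibreCounts (s ∸ 1) κ h (gcd A (s ∸ 1)) #[ solvable? ] (Q ∸ 1) (#fibres 0) (#fibres 1) (#fibres s)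
    gcd*h≡κ*[s∸1] #solvable #solvable≡ Q∸1≡#fibres-1+#solvable Q∸1≡#fibres
  f₀*h*s : #fibres 0 * (h * s) ≡ κ * (s ∸ 1) * Q
  f₀*h*s = subst₂ (λ x y → #fibres 0 * (h * x) ≡ κ * (s ∸ 1) * y) (suc[n∸1]≡n s) (suc[n∸1]≡n Q)
    f₀*[h*s]
  fₛ*h*s : #fibres s * (h * s) ≡ κ * (Q ∸ s)
  fₛ*h*s = subst (λ x → #fibres s * (h * x) ≡ κ * (Q ∸ x)) (suc[n∸1]≡n s)
    -- The difference (Q - 1) - (s - 1) is rewritten as Q - (1 + (s - 1)), whose subtrahend is then
    -- identified with s.
    (trans fₛ*[h*s]
           (cong (κ *_) (ℕ.∸-+-assoc Q 1 (s ∸ 1))))
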